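{- If $G$ is a subcubic graph of order $n$ with no isolated vertex, then $i(G) \le \frac{1}{2}n$. Further, if $G$ is connected, then $i(G)=\frac{1}{2}n$ if and only if one of the following holds: (a) $G \in \{G_1,G_2,G_3,G_4,G_5\}$; (b) $n=2k$ for some $k\ge 1$ and $G=\mathrm{cor}(P_k)$; (c) $n=2k$ for some $k\ge 3$ and $G=\mathrm{cor}(C_k)$.
   Context: A subcubic graph is a graph of maximum degree at most $3$. $i(G)$ is the minimum cardinality of an independent set $S$ of vertices such that every vertex not in $S$ is adjacent to a vertex of $S$. $P_k$ and $C_k$ are the path and cycle on $k$ vertices; $\mathrm{cor}(F)$ is the graph obtained from $F$ by adding a pendant edge (a new leaf) at each vertex of $F$. $G_1=K_{2,2}$; $G_2=K_{3,3}$; $G_3$ is obtained from $K_{2,3}$ by adding a new vertex adjacent to exactly one vertex of the part of size $3$; $G_4$ is the double star $S(2,2)$ (two adjacent vertices, each adjacent to two further leaves); $G_5$ is obtained from the path $a_1a_2a_3a_4a_5a_6$ by adding the edge $a_2a_5$. -}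

module Defs where

open import Data.Bool using (Bool; true; false; not; _∧_; _∨_; if_then_else_)
open import Data.Nat using (ℕ; zero; suc; _+_; _*_; _≤_; _≡ᵇ_)
open import Data.Fin using (Fin; toℕ; splitAt; #_)
open import Data.Fin.Subset using (Subset; _∈_; _∉_; ∣_∣)
open import Data.List using (List; []; _∷_; map; allFin)
open import Data.Bool.ListAction using (any)
open import Data.Nat.ListAction using (sum)
open import Data.Product using (Σ; _×_; _,_; ∃)
open import Data.Sum using (_⊎_; inj₁; inj₂)
open import Function.Bundles using (_↔_; Inverse)
open import Relation.Binary.PropositionalEquality using (_≡_; refl)

record Graph (n : ℕ) : Set where
  field
    adj    : Fin n → Fin n → Bool
    sym    : ∀ u v → adj u v ≡ adj v u
    irrefl : ∀ v → adj v v ≡ false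
open Graph public

_==_ : ∀ {n} → Fin n → Fin n → Bool
i == j = toℕ i ≡ᵇ toℕ j

private
  ≡ᵇ-sym : ∀ a b → (a ≡ᵇ b) ≡ (b ≡ᵇ a)
  ≡ᵇ-sym zero zero = refl
  ≡ᵇ-sym zero (suc b) = refl
  ≡ᵇ-sym (suc a) zero = refl
  ≡ᵇ-sym (suc a) (suc b) = ≡ᵇ-sym a b

  ≡ᵇ-refl : ∀ a → (a ≡ᵇ a) ≡ true
  ≡ᵇ-refl zero = refl
  ≡ᵇ-refl (suc a) = ≡ᵇ-refl a

  ∨-comm : ∀ a b → (a ∨ b) ≡ (b ∨ a)
  ∨-comm true true = refl
  ∨-comm true false = refl
  ∨-comm false true = refl
  ∨-comm false false = refl

  close-sym : ∀ {n} (e : Fin n → Fin n → Bool) u v →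
    (not (u == v) ∧ (e u v ∨ e v u)) ≡ (not (v == u) ∧ (e v u ∨ e u v))
  close-sym e u v rewrite ≡ᵇ-sym (toℕ u) (toℕ v) | ∨-comm (e u v) (e v u) = refl

  close-irrefl : ∀ {n} (e : Fin n → Fin n → Bool) v →
    (not (v == v) ∧ (e v v ∨ e v v)) ≡ false
  close-irrefl e v rewrite ≡ᵇ-refl (toℕ v) = refl

mkGraph : ∀ {n} → (Fin n → Fin n → Bool) → Graph n
mkGraph e = record
  { adj    = λ u v → not (u == v) ∧ (e u v ∨ e v u)
  ; sym    = close-sym e
  ; irrefl = close-irrefl e }

fromEdges : ∀ {n} → List (Fin n × Fin n) → Graph n
fromEdges es = mkGraph (λ u v → any (λ { (a , b) → (u == a) ∧ (v == b) }) es)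

Adj : ∀ {n} → Graph n → Fin n → Fin n → Set
Adj G u v = adj G u v ≡ true

deg : ∀ {n} → Graph n → Fin n → ℕ
deg {n} G u = sum (map (λ v → if adj G u v then 1 else 0) (allFin n))

Subcubic : ∀ {n} → Graph n → Set
Subcubic {n} G = ∀ (u : Fin n) → deg G u ≤ 3

NoIsolated : ∀ {n} → Graph n → Set
NoIsolated {n} G = ∀ (u : Fin n) → ∃ λ v → Adj G u v

data Reach {n} (G : Graph n) : Fin n → Fin n → Set where
  here : ∀ {u} → Reach G u u
  step : ∀ {u v w} → Adj G u v → Reach G v w → Reach G u w

Connected : ∀ {n} → Graph n → Set
Connected {n} G = ∀ (u v : Fin n) → Reach G u v

_≅_ : ∀ {n m} → Graph n → Graph m → Set
_≅_ {n} {m} G H = Σ (Fin n ↔ Fin m) λ f →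
  ∀ u v → adj G u v ≡ adj H (Inverse.to f u) (Inverse.to f v)

Independent : ∀ {n} → Graph n → Subset n → Set
Independent {n} G S = ∀ (u v : Fin n) → u ∈ S → v ∈ S → adj G u v ≡ false

Dominating : ∀ {n} → Graph n → Subset n → Set
Dominating {n} G S = ∀ (u : Fin n) → u ∉ S → ∃ λ v → v ∈ S × Adj G u v

IndepDom : ∀ {n} → Graph n → Subset n → Set
IndepDom G S = Independent G S × Dominating G S

IsIndepDomNumber : ∀ {n} → Graph n → ℕ → Set
IsIndepDomNumber {n} G k =
  (∃ λ (S : Subset n) → IndepDom G S × ∣ S ∣ ≡ k) ×
  (∀ (S : Subset n) → IndepDom G S → k ≤ ∣ S ∣)

PathG : (k : ℕ) → Graph k
PathG k = mkGraph (λ i j → toℕ j ≡ᵇ suc (toℕ i))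

CycleG : (k : ℕ) → Graph k
CycleG k = mkGraph (λ i j → (toℕ j ≡ᵇ suc (toℕ i)) ∨ ((suc (toℕ i) ≡ᵇ k) ∧ (toℕ j ≡ᵇ 0)))

-- Corona cor(F): vertex inj₁ i is the original vertex i, inj₂ i its new leaf
cor : ∀ {k} → Graph k → Graph (k + k)
cor {k} F = mkGraph e
  where
  e : Fin (k + k) → Fin (k + k) → Bool
  e u v with splitAt k u | splitAt k v
  ... | inj₁ i | inj₁ j = adj F i j
  ... | inj₁ i | inj₂ j = i == j
  ... | inj₂ i | inj₁ j = i == j
  ... | inj₂ i | inj₂ j = false

-- G1 = K_{2,2}: parts {0,1}, {2,3}
G1 : Graph 4
G1 = fromEdges ((# 0 , # 2) ∷ (# 0 , # 3) ∷ (# 1 , # 2) ∷ (# 1 , # 3) ∷ [])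

-- G2 = K_{3,3}: parts {0,1,2}, {3,4,5}
G2 : Graph 6
G2 = fromEdges ((# 0 , # 3) ∷ (# 0 , # 4) ∷ (# 0 , # 5) ∷
                (# 1 , # 3) ∷ (# 1 , # 4) ∷ (# 1 , # 5) ∷
                (# 2 , # 3) ∷ (# 2 , # 4) ∷ (# 2 , # 5) ∷ [])

-- G3 = K_{2,3} (parts {0,1}, {2,3,4}) plus vertex 5 adjacent to 2
G3 : Graph 6
G3 = fromEdges ((# 0 , # 2) ∷ (# 0 , # 3) ∷ (# 0 , # 4) ∷
                (# 1 , # 2) ∷ (# 1 , # 3) ∷ (# 1 , # 4) ∷
                (# 2 , # 5) ∷ [])

-- G4 = double star S(2,2): centres 0,1; leaves 2,3 on 0 and 4,5 on 1
G4 : Graph 6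
G4 = fromEdges ((# 0 , # 1) ∷ (# 0 , # 2) ∷ (# 0 , # 3) ∷
                (# 1 , # 4) ∷ (# 1 , # 5) ∷ [])

-- G5 = path a1…a6 (vertices 0…5) plus edge a2a5 (1–4)
G5 : Graph 6
G5 = fromEdges ((# 0 , # 1) ∷ (# 1 , # 2) ∷ (# 2 , # 3) ∷
                (# 3 , # 4) ∷ (# 4 , # 5) ∷ (# 1 , # 4) ∷ [])

{-# OPTIONS --safe #-}
-- Call p a captive of v if p ≠ v is not isolated and N(p) ⊆ N(v); write k for the number of captives
-- of v and d for its degree. Removing N[v] isolates exactly the captives of v, so a selection S′ of the
-- rest extends to S′ ∪ {v} ∪ captives, and 2|S| + d ≤ n + 1 + k whenever 2|S′| is at most the number of
-- surviving vertices. In a subcubic graph with an edge some v has k < d, which gives i(G) ≤ n/2 by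
-- induction; and if i(G) = n/2, then d ≤ 1 + k must hold at every v. This local condition alone
-- determines a connected graph: without leaves it is C₄ or K₃,₃, a vertex with two leaves forces
-- S(2,2), a non-leaf without a leaf neighbour forces G₃ or G₅, and otherwise the graph is K₂ or the
-- corona of a connected graph of maximum degree at most 2, that is, of a path or a cycle.

module Submission where

open import Defs
import Data.Nat.Properties
open import Algebra.Properties.CommutativeMonoid.Sum Data.Nat.Properties.+-0-commutativeMonoid
  using (∑-distrib-+; sum-permute; sum-cong-≗; sum-replicate-zero) renaming (sum to Σᶠ)
open import Data.Bool using (Bool; true; false; if_then_else_; _∧_; _∨_; not)
import Data.Bool as Bool
open import Data.Bool.Properties using (T-≡; T-∨; T-∧; ∧-comm)
open import Data.Empty using (⊥; ⊥-elim)
open import Data.Fin using (Fin; zero; suc; _≟_; toℕ; fromℕ<; splitAt; join; _↑ˡ_; _↑ʳ_)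
open import Data.Fin.Patterns
open import Data.Fin.Permutation using (↔⇒≡; inverseˡ; inverseʳ)
open import Data.Fin.Properties using (any?; all?; toℕ-injective; toℕ<n; toℕ-fromℕ<; injective⇒≤;
  join-splitAt; splitAt-join; splitAt-↑ʳ; splitAt⁻¹-↑ˡ)
open import Data.Fin.Subset using (Subset; ∣_∣; _∈_)
open import Data.Fin.Subset.Properties using (_∈?_; anySubset?)
open import Data.List using (List; []; _∷_; length; filter; allFin; map; lookup; tabulate)
open import Data.List.Membership.DecPropositional using () renaming (_∈?_ to mem?)
open import Data.List.Membership.Propositional using () renaming (_∈_ to _∈ˡ_)
open import Data.List.Membership.Propositional.Properties
  using (∈-filter⁺; ∈-filter⁻; ∈-allFin; ∈-lookup; ∈-map⁺; ∈-map⁻)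
open import Data.List.Properties using (map-tabulate)
open import Data.List.Relation.Unary.All using (All; []; _∷_)
import Data.List.Relation.Unary.All as All
open import Data.List.Relation.Unary.AllPairs using ([]; _∷_)
open import Data.List.Relation.Unary.Any using (here; there)
open import Data.List.Relation.Unary.Unique.Propositional using (Unique)
open import Data.List.Relation.Unary.Unique.Propositional.Properties using (filter⁺; allFin⁺)
open import Data.Nat using (ℕ; zero; suc; _+_; _*_; _≤_; _<_; _≤?_; _≡ᵇ_; z≤n; s≤s; s≤s⁻¹)
open import Data.Nat.Induction using (<-wellFounded)
import Data.Nat.ListAction as ListAction
open import Data.Nat.Properties
  using (*-monoʳ-≤; +-assoc; +-cancelʳ-≤; +-identityʳ; +-mono-≤; +-monoʳ-≤; +-monoˡ-≤; +-suc; 1+n≢n;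
    1+n≰n; <-irrefl; <-trans; <-≤-trans; <⇒≢; <⇒≤; module ≤-Reasoning; m≤n+m; m≤n⇒m<n∨m≡n; n<1+n;
    n≤1+n; ≡ᵇ⇒≡; ≡⇒≡ᵇ; ≤-antisym; ≤-refl; ≤-reflexive; ≤-trans; ≮⇒≥)
open import Data.Nat.Solver using (module +-*-Solver)
open import Data.Product using (Σ; _×_; ∃; ∃₂; _,_; proj₁; proj₂)
open import Data.Sum using (_⊎_; inj₁; inj₂; [_,_]′)
import Data.Vec as Vec
open import Data.Vec.Properties using (lookup∘tabulate; []=⇒lookup; lookup⇒[]=)
open import Function using (_∘_)
open import Function.Bundles using (_⇔_; mk⇔; mk↔ₛ′; Inverse; Equivalence)
open import Induction.WellFounded using (Acc; acc)
open import Relation.Binary.PropositionalEquality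
  using (_≡_; _≢_; refl; trans; cong; cong₂; subst; subst₂; ≢-sym) renaming (sym to ≡-sym)
open import Relation.Nullary using (¬_; Dec; yes; no; contradiction)
open import Relation.Nullary.Decidable using (⌊_⌋; True; False; toWitness; toWitnessFalse;
  decidable-stable; ¬?; _×-dec_; _⊎-dec_; _→-dec_)

-- The induction has to live with isolated vertices, since removing N[v] strands the captives of v.
-- The bound is therefore proved for `Selection`s, which see only active vertices, against
-- `activeCount`; it becomes a bound in n once `NoIsolated` holds. Taking all captives along with v
-- keeps the set independent: a captive adjacent to v would put v into N(v), and a captive adjacent
-- to another captive would put the latter into N(v), which was just excluded. If k ≥ d held at
-- every active vertex, the captives would overcrowd a neighbour, which has only three places. With
-- one captive fewer, as in the equality case, the main tool is this: a captive of v that misses all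
-- but one neighbour of v is a leaf at the remaining one. Leaves and their supports are forced in
-- this way. When no exceptional configuration occurs and a non-leaf exists, every non-leaf carries
-- exactly one leaf, so it has at most two other neighbours, and a walk among the non-leaves that
-- never turns back traces the path or the cycle.

private variable n : ℕ

-- Counting and listing the elements of a Boolean predicate.

ind : Bool → ℕ
ind b = if b then 1 else 0

count : (Fin n → Bool) → ℕ
count p = Σᶠ (λ x → ind (p x))

Σᶠ-mono : {f g : Fin n → ℕ} → (∀ x → f x ≤ g x) → Σᶠ f ≤ Σᶠ g
Σᶠ-mono {zero}  h = z≤n
Σᶠ-mono {suc n} h = +-mono-≤ (h zero) (Σᶠ-mono (λ x → h (suc x)))

ind-mono : ∀ {a b} → (a ≡ true → b ≡ true) → ind a ≤ ind b
ind-mono {false}         h = z≤n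
ind-mono {true}  {true}  h = ≤-refl
ind-mono {true}  {false} h with () ← h refl

count-mono : {p q : Fin n → Bool} → (∀ x → p x ≡ true → q x ≡ true) → count p ≤ count q
count-mono h = Σᶠ-mono (λ x → ind-mono (h x))

Σᶠ-allFin : (f : Fin n → ℕ) → ListAction.sum (map f (allFin n)) ≡ Σᶠ f
Σᶠ-allFin {n} f = trans (cong ListAction.sum (map-tabulate (λ x → x) f)) (go n f)
  where
  go : ∀ n (f : Fin n → ℕ) → ListAction.sum (tabulate f) ≡ Σᶠ f
  go zero    f = refl
  go (suc n) f = cong (f zero +_) (go n (λ x → f (suc x)))

count-≟ : (v : Fin n) → count (λ x → ⌊ x ≟ v ⌋) ≡ 1
count-≟ {suc n} zero    = cong suc (sum-replicate-zero n)
count-≟ {suc n} (suc v) =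
  trans (sum-cong-≗ {n} (λ x → cong ind (lemma x))) (count-≟ v)
  where
  lemma : ∀ x → ⌊ suc x ≟ suc v ⌋ ≡ ⌊ x ≟ v ⌋
  lemma x with x ≟ v
  ... | yes _ = refl
  ... | no  _ = refl

count-∈ : {xs : List (Fin n)} → Unique xs → count (λ x → ⌊ mem? _≟_ x xs ⌋) ≡ length xs
count-∈ {n} {[]}     []          = sum-replicate-zero n
count-∈ {n} {v ∷ xs} (v∉ ∷ uniq) =
  trans (sum-cong-≗ {n} split) (trans (∑-distrib-+ {n} _ _) (cong₂ _+_ (count-≟ v) (count-∈ uniq)))
  where
  split : ∀ x → ind ⌊ mem? _≟_ x (v ∷ xs) ⌋ ≡ ind ⌊ x ≟ v ⌋ + ind ⌊ mem? _≟_ x xs ⌋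
  split x with x ≟ v | mem? _≟_ x xs
  ... | yes refl | yes x∈ = contradiction refl (All.lookup v∉ x∈)
  ... | yes _    | no  _  = refl
  ... | no  _    | yes _  = refl
  ... | no  _    | no  _  = refl

⌊⌋-true : ∀ {P : Set} (P? : Dec P) → P → ⌊ P? ⌋ ≡ true
⌊⌋-true (yes _) _ = refl
⌊⌋-true (no ¬p) p = contradiction p ¬p

⌊⌋-holds : ∀ {P : Set} (P? : Dec P) → ⌊ P? ⌋ ≡ true → P
⌊⌋-holds (yes p) _ = p

unique-length≤count : {p : Fin n → Bool} {xs : List (Fin n)} →
  Unique xs → All (λ x → p x ≡ true) xs → length xs ≤ count p
unique-length≤count {p = p} {xs} uniq all = subst (_≤ count p) (count-∈ uniq)
  (count-mono (λ x x∈ → All.lookup all (⌊⌋-holds (mem? _≟_ x xs) x∈)))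

-- Pattern matching on `elems` turns a bound on a count, or on a degree, into named distinct
-- vertices.
record Listing {n} (p : Fin n → Bool) : Set where
  field
    elems    : List (Fin n)
    unique   : Unique elems
    sound    : All (λ x → p x ≡ true) elems
    complete : ∀ x → p x ≡ true → x ∈ˡ elems
    size     : length elems ≡ count p

listing : (p : Fin n → Bool) → Listing p
listing {n} p = record
  { elems = xs ; unique = uniq ; sound = All.tabulate sound ; complete = complete
  ; size = trans (≡-sym (count-∈ uniq)) (sum-cong-≗ {n} eq) }
  where
  P? : ∀ x → Dec (p x ≡ true)
  P? x = p x Bool.≟ true
  xs = filter P? (allFin n)
  uniq = filter⁺ P? (allFin⁺ n)
  sound : ∀ {x} → x ∈ˡ xs → p x ≡ true
  sound x∈ = proj₂ (∈-filter⁻ P? {xs = allFin n} x∈)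
  complete : ∀ x → p x ≡ true → x ∈ˡ xs
  complete x px = ∈-filter⁺ P? (∈-allFin x) px
  eq : ∀ x → ind ⌊ mem? _≟_ x xs ⌋ ≡ ind (p x)
  eq x with mem? _≟_ x xs | p x in px
  ... | yes x∈ | false with () ← trans (≡-sym px) (sound x∈)
  ... | yes x∈ | true  = refl
  ... | no  x∉ | true  = contradiction (complete x px) x∉
  ... | no  x∉ | false = refl

-- An `x` in `q` but not in `p`, put in front of a listing of `p`, would give a duplicate-free list
-- inside `q` that is longer than `count q` allows.
count-⊆-≥ : {p q : Fin n → Bool} → (∀ x → p x ≡ true → q x ≡ true) →
  count q ≤ count p → ∀ x → q x ≡ true → p x ≡ true
count-⊆-≥ {p = p} {q} p⊆q q≤p x qx with p x in px
... | true  = refl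
... | false = contradiction
  (≤-trans (subst (_< length (x ∷ elems)) size ≤-refl)
     (≤-trans (unique-length≤count
        (All.tabulate (λ {y} y∈ x≡y → contradiction
            (trans (≡-sym px) (trans (cong p x≡y) (All.lookup sound y∈))) (λ ()))
          ∷ unique)
        (qx ∷ All.map (p⊆q _) sound))
      q≤p))
  1+n≰n
  where open Listing (listing p)

pick₁ : (p : Fin n → Bool) → 1 ≤ count p → ∃ λ x → p x ≡ true
pick₁ p h with listing p
... | record { elems = [] ; size = eq } with () ← subst (1 ≤_) (≡-sym eq) h
... | record { elems = x ∷ _ ; sound = px ∷ _ } = x , px

pick₂ : (p : Fin n → Bool) → 2 ≤ count p →
  ∃₂ λ x y → x ≢ y × p x ≡ true × p y ≡ true
pick₂ p h with listing p
... | record { elems = [] ; size = eq } with () ← subst (2 ≤_) (≡-sym eq) h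
... | record { elems = _ ∷ [] ; size = eq } with s≤s () ← subst (2 ≤_) (≡-sym eq) h
... | record { elems = x ∷ y ∷ _ ; unique = (x≢y ∷ _) ∷ _ ; sound = px ∷ py ∷ _ } =
  x , y , x≢y , px , py

pick₃ : (p : Fin n → Bool) → 3 ≤ count p →
  ∃ λ x → ∃₂ λ y z → (x ≢ y × x ≢ z × y ≢ z) × p x ≡ true × p y ≡ true × p z ≡ true
pick₃ p h with listing p
... | record { elems = [] ; size = eq } with () ← subst (3 ≤_) (≡-sym eq) h
... | record { elems = _ ∷ [] ; size = eq } with s≤s () ← subst (3 ≤_) (≡-sym eq) h
... | record { elems = _ ∷ _ ∷ [] ; size = eq } with s≤s (s≤s ()) ← subst (3 ≤_) (≡-sym eq) h
... | record { elems = x ∷ y ∷ z ∷ _ ; unique = (x≢y ∷ x≢z ∷ _) ∷ (y≢z ∷ _) ∷ _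
             ; sound = px ∷ py ∷ pz ∷ _ } =
  x , y , z , (x≢y , x≢z , y≢z) , px , py , pz

-- Captives in subcubic graphs

Active : ∀ {n} → Graph n → Fin n → Set
Active G u = ∃ λ v → Adj G u v

adj? : ∀ {n} (G : Graph n) u v → Dec (Adj G u v)
adj? G u v = adj G u v Bool.≟ true

active? : ∀ {n} (G : Graph n) u → Dec (Active G u)
active? G u = any? (adj? G u)

Captive : ∀ {n} → Graph n → Fin n → Fin n → Set
Captive G v p = p ≢ v × Active G p × (∀ x → Adj G p x → Adj G v x)

captive? : ∀ {n} (G : Graph n) v p → Dec (Captive G v p)
captive? G v p = ¬? (p ≟ v) ×-dec active? G p ×-dec all? (λ x → adj? G p x →-dec adj? G v x)

captives : ∀ {n} → Graph n → Fin n → ℕ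
captives G v = count (λ p → ⌊ captive? G v p ⌋)

deg≡count : ∀ {n} (G : Graph n) v → deg G v ≡ count (adj G v)
deg≡count G v = Σᶠ-allFin (λ x → ind (adj G v x))

record Nbrs {n} (G : Graph n) (v : Fin n) (xs : List (Fin n)) : Set where
  constructor nbrs
  field
    unique : Unique xs
    each   : All (Adj G v) xs
    only   : ∀ x → Adj G v x → x ∈ˡ xs

module SubcubicGraph {n} (G : Graph n) (sub : Subcubic G) where

  infix 4 _~_
  _~_ : Fin n → Fin n → Set
  _~_ = Adj G

  ~-sym : ∀ {u v} → u ~ v → v ~ u
  ~-sym {u} {v} uv = trans (sym G v u) uv

  ~⇒≢ : ∀ {u v} → u ~ v → u ≢ v
  ~⇒≢ {u} uv refl with () ← trans (≡-sym uv) (irrefl G u)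

  ≁⇒≢ : ∀ {u v w} → u ~ w → ¬ v ~ w → u ≢ v
  ≁⇒≢ uw ¬vw refl = ¬vw uw

  length≤deg : ∀ {v xs} → Unique xs → All (v ~_) xs → length xs ≤ deg G v
  length≤deg {v} u a = subst (_ ≤_) (≡-sym (deg≡count G v)) (unique-length≤count u a)

  Nbrs⇒deg≤ : ∀ {v xs} → Nbrs G v xs → deg G v ≤ length xs
  Nbrs⇒deg≤ {v} {xs} N = subst (_≤ length xs) (≡-sym (deg≡count G v))
    (subst (count (adj G v) ≤_) (count-∈ (Nbrs.unique N))
      (count-mono (λ x vx → ⌊⌋-true (mem? _≟_ x xs) (Nbrs.only N x vx))))

  -- One more neighbour in front of `xs` would make a duplicate-free list of neighbours longer than
  -- the degree.
  all-nbrs : ∀ {v xs} → Unique xs → All (v ~_) xs → deg G v ≤ length xs → Nbrs G v xs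
  all-nbrs {v} {xs} u a d≤ = nbrs u a only
    where
    only : ∀ x → v ~ x → x ∈ˡ xs
    only x vx with mem? _≟_ x xs
    ... | yes x∈ = x∈
    ... | no  x∉ = contradiction
      (≤-trans (length≤deg (All.tabulate (λ {y} y∈ x≡y → x∉ (subst (_∈ˡ xs) (≡-sym x≡y) y∈)) ∷ u) (vx ∷ a)) d≤)
      1+n≰n

  nbrs₁ : ∀ {v a} → v ~ a → (∀ x → v ~ x → x ≡ a) → Nbrs G v (a ∷ [])
  nbrs₁ va only = nbrs ([] ∷ []) (va ∷ []) (λ x vx → here (only x vx))

  nbrs₂ : ∀ {v a b s t} → Nbrs G v (s ∷ t ∷ []) → a ≢ b → v ~ a → v ~ b → Nbrs G v (a ∷ b ∷ [])
  nbrs₂ N a≢b va vb = all-nbrs ((a≢b ∷ []) ∷ [] ∷ []) (va ∷ vb ∷ []) (Nbrs⇒deg≤ N)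

  nbrs₃ : ∀ {v a b c} → a ≢ b → a ≢ c → b ≢ c → v ~ a → v ~ b → v ~ c → Nbrs G v (a ∷ b ∷ c ∷ [])
  nbrs₃ {v} a≢b a≢c b≢c va vb vc =
    all-nbrs ((a≢b ∷ a≢c ∷ []) ∷ (b≢c ∷ []) ∷ [] ∷ []) (va ∷ vb ∷ vc ∷ []) (sub v)

  -- Reorders a neighbourhood of size three so that two neighbours already known stand in front and
  -- the remaining one gets a name.
  third : ∀ {v a b r s t} → Nbrs G v (r ∷ s ∷ t ∷ []) → a ≢ b → v ~ a → v ~ b →
    ∃ λ c → Nbrs G v (a ∷ b ∷ c ∷ [])
  third N@(nbrs ((r≢s ∷ r≢t ∷ []) ∷ (s≢t ∷ []) ∷ [] ∷ []) (vr ∷ vs ∷ vt ∷ []) only) a≢b va vb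
    with only _ va | only _ vb
  ... | here refl                 | here refl                 = contradiction refl a≢b
  ... | here refl                 | there (here refl)         = _ , nbrs₃ r≢s r≢t s≢t va vb vt
  ... | here refl                 | there (there (here refl)) = _ , nbrs₃ r≢t r≢s (≢-sym s≢t) va vb vs
  ... | there (here refl)         | here refl                 = _ , nbrs₃ a≢b s≢t r≢t va vb vt
  ... | there (here refl)         | there (here refl)         = contradiction refl a≢b
  ... | there (here refl)         | there (there (here refl)) = _ , nbrs₃ a≢b (≢-sym r≢s) (≢-sym r≢t) va vb vr
  ... | there (there (here refl)) | here refl                 = _ , nbrs₃ a≢b (≢-sym s≢t) r≢s va vb vs
  ... | there (there (here refl)) | there (here refl)         = _ , nbrs₃ a≢b (≢-sym r≢t) (≢-sym r≢s) va vb vr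
  ... | there (there (here refl)) | there (there (here refl)) = contradiction refl a≢b

  data View (v : Fin n) : Set where
    one   : ∀ a → Nbrs G v (a ∷ []) → View v
    two   : ∀ a b → Nbrs G v (a ∷ b ∷ []) → View v
    three : ∀ a b c → Nbrs G v (a ∷ b ∷ c ∷ []) → View v

  view : ∀ v → Active G v → View v
  view v (u , vu) with listing (adj G v)
  ... | record { elems = [] ; complete = c } with () ← c u vu
  ... | record { elems = a ∷ [] ; unique = q ; sound = s ; complete = c } = one a (nbrs q s c)
  ... | record { elems = a ∷ b ∷ [] ; unique = q ; sound = s ; complete = c } = two a b (nbrs q s c)
  ... | record { elems = a ∷ b ∷ d ∷ [] ; unique = q ; sound = s ; complete = c } = three a b d (nbrs q s c)
  ... | record { elems = _ ∷ _ ∷ _ ∷ _ ∷ _ ; unique = q ; sound = s }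
    with s≤s (s≤s (s≤s ())) ← ≤-trans (length≤deg q s) (sub v)

  leaf-nbr : ∀ {l u x} → Nbrs G l (u ∷ []) → l ~ x → x ≡ u
  leaf-nbr N lx with here eq ← Nbrs.only N _ lx = eq

  leaf-captive : ∀ {l u p} → Nbrs G l (u ∷ []) → p ~ l → p ≡ u
  leaf-captive N pl = leaf-nbr N (~-sym pl)

  2≤deg : ∀ {v} → Active G v → (∀ a → ¬ Nbrs G v (a ∷ [])) → 2 ≤ deg G v
  2≤deg {v} act ¬leaf with view v act
  ... | one a N = contradiction N (¬leaf a)
  ... | two _ _ (nbrs q s _) = length≤deg q s
  ... | three _ _ _ (nbrs q s _) = ≤-trans (s≤s (s≤s z≤n)) (length≤deg q s)

  -- N(p) lies in N(v) and is at least as large, so the two neighbourhoods coincide.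
  twin : ∀ {v p} → Captive G v p → deg G v ≤ deg G p → ∀ {x} → v ~ x → p ~ x
  twin {v} {p} (_ , _ , ⊆) d≤ {x} = count-⊆-≥ ⊆
    (subst (_≤ count (adj G p)) (deg≡count G v) (subst (deg G v ≤_) (deg≡count G p) d≤)) x

  captive₁ : ∀ {v} → 1 ≤ captives G v → ∃ (Captive G v)
  captive₁ {v} h with pick₁ _ h
  ... | p , kp = p , ⌊⌋-holds (captive? G v p) kp

  captive₂ : ∀ {v} → 2 ≤ captives G v → ∃₂ λ p q → p ≢ q × Captive G v p × Captive G v q
  captive₂ {v} h with pick₂ _ h
  ... | p , q , p≢q , kp , kq =
    p , q , p≢q , ⌊⌋-holds (captive? G v p) kp , ⌊⌋-holds (captive? G v q) kq

  captive₃ : ∀ {v} → 3 ≤ captives G v → ∃ λ p → ∃₂ λ q r → (p ≢ q × p ≢ r × q ≢ r) ×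
    Captive G v p × Captive G v q × Captive G v r
  captive₃ {v} h with pick₃ _ h
  ... | p , q , r , d , kp , kq , kr = p , q , r , d ,
    ⌊⌋-holds (captive? G v p) kp , ⌊⌋-holds (captive? G v q) kq , ⌊⌋-holds (captive? G v r) kr

  no-four : ∀ {v a b c d} → a ≢ b → a ≢ c → a ≢ d → b ≢ c → b ≢ d → c ≢ d →
    v ~ a → v ~ b → v ~ c → v ~ d → ⊥
  no-four {v} ab ac ad bc bd cd va vb vc vd
    with s≤s (s≤s (s≤s ())) ← ≤-trans (length≤deg
      ((ab ∷ ac ∷ ad ∷ []) ∷ (bc ∷ bd ∷ []) ∷ (cd ∷ []) ∷ [] ∷ [])
      (va ∷ vb ∷ vc ∷ vd ∷ [])) (sub v)

  module _ (crowded : ∀ v → Active G v → deg G v ≤ captives G v) where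
    private
      crowd : ∀ {v x xs} → Nbrs G v (x ∷ xs) → length (x ∷ xs) ≤ captives G v
      crowd {v} {x} (nbrs q s@(vx ∷ _) _) = ≤-trans (length≤deg q s) (crowded v (x , vx))

      -- A captive `x` of a leaf `v` at `u` is a second leaf at `u`. A captive of `u` cannot touch
      -- `v` or `x`, whose only neighbour is `u`. So `u` has a third neighbour `w`, all three
      -- captives of `u` hang on `w`, and together with `u` they give `w` degree four.
      no-leaf : ∀ {v u} → ¬ Nbrs G v (u ∷ [])
      no-leaf {v} {u} N@(nbrs _ (vu ∷ []) _) with captive₁ (crowd N)
      ... | x , x≢v , (y , xy) , ⊆ = at-support (view u (v , uv))
        where
        Nx : Nbrs G x (u ∷ [])
        Nx = nbrs₁ (subst (x ~_) (leaf-nbr N (⊆ y xy)) xy) (λ z xz → leaf-nbr N (⊆ z xz))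
        uv = ~-sym vu
        ux = ~-sym (All.head (Nbrs.each Nx))
        at-support : View u → ⊥
        at-support (one a N′) = x≢v (trans (leaf-nbr N′ ux) (≡-sym (leaf-nbr N′ uv)))
        at-support (two _ _ N′) with nbrs₂ N′ (≢-sym x≢v) uv ux
        ... | N″ with captive₁ (≤-trans (s≤s z≤n) (crowd N″))
        ... | z , z≢u , (t , zt) , ⊆′ with Nbrs.only N″ t (⊆′ t zt)
        ... | here refl         = z≢u (leaf-captive N zt)
        ... | there (here refl) = z≢u (leaf-captive Nx zt)
        at-support (three _ _ _ N′) with third N′ (≢-sym x≢v) uv ux
        ... | w , N″@(nbrs _ (_ ∷ _ ∷ uw ∷ []) _) with captive₃ (crowd N″)
        ... | a , b , c , (ab , ac , bc) , Ka , Kb , Kc =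
          no-four ab ac (proj₁ Ka) bc (proj₁ Kb) (proj₁ Kc) (to-w Ka) (to-w Kb) (to-w Kc) (~-sym uw)
          where
          to-w : ∀ {z} → Captive G u z → w ~ z
          to-w (z≢u , (t , zt) , ⊆′) with Nbrs.only N″ t (⊆′ t zt)
          ... | here refl                 = contradiction (leaf-captive N zt) z≢u
          ... | there (here refl)         = contradiction (leaf-captive Nx zt) z≢u
          ... | there (there (here refl)) = ~-sym zt

      -- Without leaves both captives `x`, `y` of `v` have neighbourhood {a, b}, so N(a) is {v, x,
      -- y}. A captive of `a` touches one of these three, hence it is `b`; yet `a` needs more than
      -- one captive.
      no-two : ∀ {v a b} → ¬ Nbrs G v (a ∷ b ∷ [])
      no-two {v} {a} {b} N@(nbrs _ (va ∷ vb ∷ []) _) with captive₂ (crowd N)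
      ... | x , y , x≢y , Kx , Ky = impossible
        where
        to-a : ∀ {z} → Captive G v z → z ~ a
        to-a K@(_ , act , _) = twin K (≤-trans (Nbrs⇒deg≤ N) (2≤deg act (λ _ → no-leaf))) va
        Na : Nbrs G a (v ∷ x ∷ y ∷ [])
        Na = nbrs₃ (≢-sym (proj₁ Kx)) (≢-sym (proj₁ Ky)) x≢y (~-sym va) (~-sym (to-a Kx)) (~-sym (to-a Ky))
        back : ∀ {t z} → (∀ w → t ~ w → v ~ w) → z ≢ a → z ~ t → z ≡ b
        back {z = z} ⊆ z≢a zt with Nbrs.only N z (⊆ z (~-sym zt))
        ... | here z≡a         = contradiction z≡a z≢a
        ... | there (here z≡b) = z≡b
        is-b : ∀ {z} → Captive G a z → z ≡ b
        is-b (z≢a , (t , zt) , ⊆) with Nbrs.only Na t (⊆ t zt)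
        ... | here refl                 = back (λ _ p → p) z≢a zt
        ... | there (here refl)         = back (proj₂ (proj₂ Kx)) z≢a zt
        ... | there (there (here refl)) = back (proj₂ (proj₂ Ky)) z≢a zt
        impossible : ⊥
        impossible with captive₂ (≤-trans (s≤s (s≤s z≤n)) (crowd Na))
        ... | z , z′ , z≢z′ , Kz , Kz′ = z≢z′ (trans (is-b Kz) (≡-sym (is-b Kz′)))

    -- In the remaining case, degree three throughout, the three captives of `v` share its
    -- neighbourhood, so `a` is adjacent to them and to `v`: four neighbours.
    crowded⇒inactive : ∀ v → ¬ Active G v
    crowded⇒inactive v act with view v act
    ... | one _ N   = no-leaf N
    ... | two _ _ N = no-two N
    ... | three a b c N@(nbrs _ (va ∷ vb ∷ vc ∷ []) _) with captive₃ (crowd N)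
    ... | x , y , z , (xy , xz , yz) , Kx , Ky , Kz =
      no-four xy xz (proj₁ Kx) yz (proj₁ Ky) (proj₁ Kz)
        (~-sym (to-a Kx)) (~-sym (to-a Ky)) (~-sym (to-a Kz)) (~-sym va)
      where
      3≤deg : ∀ {w} → Active G w → 3 ≤ deg G w
      3≤deg {w} act with view w act
      ... | one _ N   = ⊥-elim (no-leaf N)
      ... | two _ _ N = ⊥-elim (no-two N)
      ... | three _ _ _ (nbrs q s _) = length≤deg q s
      to-a : ∀ {w} → Captive G v w → w ~ a
      to-a K@(_ , act , _) = twin K (≤-trans (Nbrs⇒deg≤ N) (3≤deg act)) va

-- The upper bound n/2

activeCount : ∀ {n} → Graph n → ℕ
activeCount G = count (λ u → ⌊ active? G u ⌋)

Near : ∀ {n} → Graph n → Fin n → Fin n → Set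
Near G v u = u ≡ v ⊎ Adj G v u

near? : ∀ {n} (G : Graph n) v u → Dec (Near G v u)
near? G v u = u ≟ v ⊎-dec adj? G v u

-- Deleting the edges at N[v] instead of its vertices keeps the vertex set Fin n.
isolate : ∀ {n} → Graph n → Fin n → Graph n
isolate G v = record
  { adj    = λ a b → adj G a b ∧ (far a ∧ far b)
  ; sym    = λ a b → cong₂ _∧_ (sym G a b) (∧-comm (far a) (far b))
  ; irrefl = λ a → cong (_∧ (far a ∧ far a)) (irrefl G a) }
  where
  far : Fin _ → Bool
  far a = not ⌊ near? G v a ⌋

isolate-adj⁻ : ∀ {n} {G : Graph n} {v a b} → Adj (isolate G v) a b →
  Adj G a b × ¬ Near G v a × ¬ Near G v b
isolate-adj⁻ {G = G} {v} {a} {b} ab with adj G a b | near? G v a | near? G v b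
... | true | no ¬a | no ¬b = refl , ¬a , ¬b

isolate-adj⁺ : ∀ {n} {G : Graph n} {v a b} → Adj G a b → ¬ Near G v a → ¬ Near G v b →
  Adj (isolate G v) a b
isolate-adj⁺ {G = G} {v} {a} {b} ab ¬a ¬b with adj G a b | near? G v a | near? G v b
... | true | yes a′ | _      = contradiction a′ ¬a
... | true | no _   | yes b′ = contradiction b′ ¬b
... | true | no _   | no _   = refl

-- An independent dominating set of the subgraph on the active vertices. Isolated vertices may not
-- be chosen and do not ask to be dominated, so vertices discarded by `isolate` drop out of the
-- problem.
record Selection {n} (G : Graph n) : Set where
  field
    chosen : Fin n → Bool
    live   : ∀ u → chosen u ≡ true → Active G u
    indep  : ∀ u v → chosen u ≡ true → chosen v ≡ true → ¬ Adj G u v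
    dom    : ∀ u → Active G u → chosen u ≢ true → ∃ λ v → chosen v ≡ true × Adj G u v
open Selection

∨-elim : ∀ {a b} → a ∨ b ≡ true → a ≡ true ⊎ b ≡ true
∨-elim {true}  _ = inj₁ refl
∨-elim {false} e = inj₂ e

∨-introʳ : ∀ a {b} → b ≡ true → a ∨ b ≡ true
∨-introʳ true  _ = refl
∨-introʳ false e = e

∨-introˡ : ∀ {a b} → a ≡ true → a ∨ b ≡ true
∨-introˡ refl = refl

ind-false : ∀ {b} → b ≢ true → ind b ≡ 0
ind-false {true}  h = contradiction refl h
ind-false {false} h = refl

-- Builds up a sum of mutually exclusive indicators one summand at a time: if `b` holds, all the
-- others vanish.
add : ∀ {b c m} → (b ≡ true → c ≡ true × m ≡ 0) → m ≤ ind c → ind b + m ≤ ind c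
add {true}  h _ with refl , refl ← h refl = ≤-refl
add {false} _ m≤ = m≤

module Isolate {n} (G : Graph n) (v : Fin n) (v-active : Active G v) where
  private
    ~-sym : ∀ {a b} → Adj G a b → Adj G b a
    ~-sym {a} {b} ab = trans (sym G b a) ab

    loop : ∀ {a} → ¬ Adj G a a
    loop {a} aa with () ← trans (≡-sym aa) (irrefl G a)

    survivor : ∀ {u} → Active (isolate G v) u → Active G u × ¬ Near G v u
    survivor {u} (w , uw) with isolate-adj⁻ {G = G} {v} {u} {w} uw
    ... | uw′ , far , _ = (w , uw′) , far

    captive-independent : ∀ {a b} → Captive G v a → ¬ Near G v b → ¬ Adj G a b
    captive-independent (_ , _ , ⊆) far ab = far (inj₂ (⊆ _ ab))

    captive-far : ∀ {a} → Captive G v a → ¬ Near G v a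
    captive-far (a≢v , _)    (inj₁ a≡v) = a≢v a≡v
    captive-far (_ , _ , ⊆)  (inj₂ va)  = loop (⊆ v (~-sym va))

    captive-idle : ∀ {a} → Captive G v a → ¬ Active (isolate G v) a
    captive-idle {a} k (w , aw) with isolate-adj⁻ {G = G} {v} {a} {w} aw
    ... | aw′ , _ , far = captive-independent k far aw′

  -- The centre, its neighbours, its captives and the vertices still active afterwards are pairwise
  -- disjoint sets of active vertices of `G`.
  activeCount-isolate : 1 + (deg G v + (captives G v + activeCount (isolate G v))) ≤ activeCount G
  activeCount-isolate = begin
    1 + (deg G v + (captives G v + activeCount (isolate G v)))
      ≡⟨ cong₂ (λ e d → e + (d + (captives G v + activeCount (isolate G v)))) (≡-sym (count-≟ v)) (deg≡count G v) ⟩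
    count (λ u → ⌊ u ≟ v ⌋) + (count (adj G v) + (captives G v + activeCount (isolate G v)))
      ≡⟨ cong (λ s → count (λ u → ⌊ u ≟ v ⌋) + (count (adj G v) + s)) (≡-sym (∑-distrib-+ {n} _ _)) ⟩
    count (λ u → ⌊ u ≟ v ⌋) + (count (adj G v)
      + Σᶠ (λ u → ind ⌊ captive? G v u ⌋ + ind ⌊ active? (isolate G v) u ⌋))
      ≡⟨ cong (count (λ u → ⌊ u ≟ v ⌋) +_) (≡-sym (∑-distrib-+ {n} _ _)) ⟩
    count (λ u → ⌊ u ≟ v ⌋) + Σᶠ (λ u → ind (adj G v u)
      + (ind ⌊ captive? G v u ⌋ + ind ⌊ active? (isolate G v) u ⌋))
      ≡⟨ ≡-sym (∑-distrib-+ {n} _ _) ⟩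
    Σᶠ (λ u → ind ⌊ u ≟ v ⌋ + (ind (adj G v u)
      + (ind ⌊ captive? G v u ⌋ + ind ⌊ active? (isolate G v) u ⌋)))
      ≤⟨ Σᶠ-mono disjoint ⟩
    activeCount G ∎
    where
    open ≤-Reasoning
    disjoint : ∀ u → ind ⌊ u ≟ v ⌋ + (ind (adj G v u)
      + (ind ⌊ captive? G v u ⌋ + ind ⌊ active? (isolate G v) u ⌋)) ≤ ind ⌊ active? G u ⌋
    disjoint u = add middle (add nbr (add captured (ind-mono (λ e → counted (proj₁ (alive e))))))
      where
      counted : Active G u → ⌊ active? G u ⌋ ≡ true
      counted = ⌊⌋-true (active? G u)
      alive : ⌊ active? (isolate G v) u ⌋ ≡ true → Active G u × ¬ Near G v u
      alive e = survivor (⌊⌋-holds (active? (isolate G v) u) e)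
      captivated : ⌊ captive? G v u ⌋ ≡ true → Captive G v u
      captivated = ⌊⌋-holds (captive? G v u)
      middle : ⌊ u ≟ v ⌋ ≡ true → ⌊ active? G u ⌋ ≡ true × _
      middle e with refl ← ⌊⌋-holds (u ≟ v) e = counted v-active ,
        cong₂ _+_ (ind-false loop) (cong₂ _+_
          (ind-false (λ k → captive-far (captivated k) (inj₁ refl)))
          (ind-false (λ a → proj₂ (alive a) (inj₁ refl))))
      nbr : adj G v u ≡ true → ⌊ active? G u ⌋ ≡ true × _
      nbr vu = counted (v , ~-sym vu) , cong₂ _+_
        (ind-false (λ k → captive-far (captivated k) (inj₂ vu)))
        (ind-false (λ a → proj₂ (alive a) (inj₂ vu)))
      captured : ⌊ captive? G v u ⌋ ≡ true → ⌊ active? G u ⌋ ≡ true × _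
      captured k = counted (proj₁ (proj₂ (captivated k))) ,
        ind-false (λ a → captive-idle (captivated k) (⌊⌋-holds (active? (isolate G v) u) a))

  module Extend (T : Selection (isolate G v)) where
    private
      picked : Fin n → Bool
      picked u = ⌊ u ≟ v ⌋ ∨ (⌊ captive? G v u ⌋ ∨ chosen T u)

      data Picked (u : Fin n) : Set where
        centre  : u ≡ v → Picked u
        captive : Captive G v u → Picked u
        old     : chosen T u ≡ true → Picked u

      picked⁻ : ∀ u → picked u ≡ true → Picked u
      picked⁻ u e with ∨-elim e
      ... | inj₁ e₁ = centre (⌊⌋-holds (u ≟ v) e₁)
      ... | inj₂ e₂ with ∨-elim e₂
      ... | inj₁ e₃ = captive (⌊⌋-holds (captive? G v u) e₃)
      ... | inj₂ e₃ = old e₃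

      picked⁺ : ∀ u → Picked u → picked u ≡ true
      picked⁺ u (centre e)  = ∨-introˡ (⌊⌋-true (u ≟ v) e)
      picked⁺ u (captive k) = ∨-introʳ ⌊ u ≟ v ⌋ (∨-introˡ (⌊⌋-true (captive? G v u) k))
      picked⁺ u (old s)     = ∨-introʳ ⌊ u ≟ v ⌋ (∨-introʳ ⌊ captive? G v u ⌋ s)

      far-of : ∀ {u} → Picked u → u ≢ v → ¬ Near G v u
      far-of (centre e)  u≢v = contradiction e u≢v
      far-of (captive k) _   = captive-far k
      far-of (old s)     _   = proj₂ (survivor (live T _ s))

      independent : ∀ a b → Picked a → Picked b → ¬ Adj G a b
      independent a b (centre refl) pb ab with b ≟ v
      ... | yes refl = loop ab
      ... | no  b≢v  = far-of pb b≢v (inj₂ ab)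
      independent a b (captive k) (centre refl) ab = captive-far k (inj₂ (~-sym ab))
      independent a b (captive k) (captive k′)  ab = captive-independent k (captive-far k′) ab
      independent a b (captive k) (old s)       ab =
        captive-independent k (proj₂ (survivor (live T b s))) ab
      independent a b (old s) (centre refl) ab = proj₂ (survivor (live T a s)) (inj₂ (~-sym ab))
      independent a b (old s) (captive k)   ab =
        captive-independent k (proj₂ (survivor (live T a s))) (~-sym ab)
      independent a b (old s) (old s′)      ab =
        indep T a b s s′ (isolate-adj⁺ {G = G} ab (proj₂ (survivor (live T a s))) (proj₂ (survivor (live T b s′))))

      dominated : ∀ u → Active G u → picked u ≢ true → ∃ λ w → picked w ≡ true × Adj G u w
      dominated u u-active u∉ with near? G v u
      ... | yes (inj₁ u≡v) = contradiction (picked⁺ u (centre u≡v)) u∉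
      ... | yes (inj₂ vu)  = v , picked⁺ v (centre refl) , ~-sym vu
      ... | no  far with active? (isolate G v) u
      ... | yes act with dom T u act (λ s → u∉ (picked⁺ u (old s)))
      ... | w , s , uw = w , picked⁺ w (old s) , proj₁ (isolate-adj⁻ {G = G} {v} {u} {w} uw)
      -- An active `u` outside N[v] that lost all its edges has every neighbour in N[v], and none of
      -- them is `v` because `u` is far. So `u` is a captive and was picked after all.
      dominated u u-active u∉ | no far | no ¬act =
        contradiction (picked⁺ u (captive ((λ e → far (inj₁ e)) , u-active , ⊆))) u∉
        where
        ⊆ : ∀ x → Adj G u x → Adj G v x
        ⊆ x ux with near? G v x
        ... | yes (inj₁ refl) = contradiction (inj₂ (~-sym ux)) far
        ... | yes (inj₂ vx)   = vx
        ... | no  far′        = contradiction (x , isolate-adj⁺ {G = G} ux far far′) ¬act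

    extend : Selection G
    extend = record
      { chosen = picked
      ; live   = λ u e → all-live {u} (picked⁻ u e)
      ; indep  = λ a b ea eb → independent a b (picked⁻ a ea) (picked⁻ b eb)
      ; dom    = dominated }
      where
      all-live : ∀ {u} → Picked u → Active G u
      all-live (centre refl)            = v-active
      all-live (captive (_ , act , _)) = act
      all-live (old s)                  = proj₁ (survivor (live T _ s))

    count-extend : count picked ≤ 1 + (captives G v + count (chosen T))
    count-extend = begin
      count picked
        ≤⟨ Σᶠ-mono (λ u → ∨-bound ⌊ u ≟ v ⌋ ⌊ captive? G v u ⌋ (chosen T u)) ⟩
      Σᶠ (λ u → ind ⌊ u ≟ v ⌋ + (ind ⌊ captive? G v u ⌋ + ind (chosen T u)))
        ≡⟨ ∑-distrib-+ {n} _ _ ⟩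
      count (λ u → ⌊ u ≟ v ⌋) + Σᶠ (λ u → ind ⌊ captive? G v u ⌋ + ind (chosen T u))
        ≡⟨ cong₂ _+_ (count-≟ v) (∑-distrib-+ {n} _ _) ⟩
      1 + (captives G v + count (chosen T)) ∎
      where
      open ≤-Reasoning
      ∨-bound : ∀ a b c → ind (a ∨ (b ∨ c)) ≤ ind a + (ind b + ind c)
      ∨-bound true  b     c = s≤s z≤n
      ∨-bound false true  c = s≤s z≤n
      ∨-bound false false c = ≤-refl

    -- The set grows by at most 1 + k vertices, each charged 2, while 1 + d + k active vertices
    -- disappear. The excess is 2(1 + k) - (1 + d + k), that is, 1 + k - d.
    extend-bound : 2 * count (chosen T) ≤ activeCount (isolate G v) →
      2 * count (chosen extend) + deg G v ≤ activeCount G + (1 + captives G v)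
    extend-bound h = begin
      2 * count picked + d            ≤⟨ +-monoˡ-≤ d (*-monoʳ-≤ 2 count-extend) ⟩
      2 * (1 + (k + s)) + d           ≡⟨ solve 3 (λ k s d → con 2 :* (con 1 :+ (k :+ s)) :+ d
                                            := con 2 :* s :+ (con 1 :+ (d :+ k) :+ (con 1 :+ k))) refl k s d ⟩
      2 * s + (1 + (d + k) + (1 + k)) ≤⟨ +-monoˡ-≤ _ h ⟩
      m + (1 + (d + k) + (1 + k))     ≡⟨ solve 3 (λ k m d → m :+ (con 1 :+ (d :+ k) :+ (con 1 :+ k))
                                            := con 1 :+ (d :+ (k :+ m)) :+ (con 1 :+ k)) refl k m d ⟩
      1 + (d + (k + m)) + (1 + k)     ≤⟨ +-monoˡ-≤ _ activeCount-isolate ⟩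
      activeCount G + (1 + k)               ∎
      where
      open ≤-Reasoning
      open +-*-Solver
      d = deg G v
      k = captives G v
      s = count (chosen T)
      m = activeCount (isolate G v)

open Isolate using (module Extend; activeCount-isolate)

isolate-subcubic : ∀ {n} {G : Graph n} {v} → Subcubic G → Subcubic (isolate G v)
isolate-subcubic {G = G} {v} sub u = ≤-trans
  (subst (_≤ deg G u) (≡-sym (deg≡count (isolate G v) u))
    (subst (count (adj (isolate G v) u) ≤_) (≡-sym (deg≡count G u))
      (count-mono (λ x ux → proj₁ (isolate-adj⁻ {G = G} {v} {u} {x} ux)))))
  (sub u)

empty : ∀ {n} {G : Graph n} → (∀ u → ¬ Active G u) → Selection G
empty idle = record
  { chosen = λ _ → false ; live = λ _ () ; indep = λ _ _ ()
  ; dom = λ u act → contradiction act (idle u) }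

HalfSelection : ∀ {n} → Graph n → Set
HalfSelection G = Σ (Selection G) λ T → 2 * count (chosen T) ≤ activeCount G

half-selection : ∀ {n} (G : Graph n) → Subcubic G → HalfSelection G
half-selection {n} G sub = go G sub (<-wellFounded (activeCount G))
  where
  go : (H : Graph n) → Subcubic H → Acc _<_ (activeCount H) → HalfSelection H
  go H sub (acc rec) with any? (λ v → active? H v ×-dec 1 + captives H v ≤? deg H v)
  ... | yes (v , act , k<d) = extend , +-cancelʳ-≤ (deg H v) _ _
    (≤-trans (extend-bound (proj₂ IH)) (+-monoʳ-≤ (activeCount H) k<d))
    where
    smaller : activeCount (isolate H v) < activeCount H
    smaller = ≤-trans (s≤s (≤-trans (m≤n+m _ _) (m≤n+m _ (deg H v)))) (activeCount-isolate H v act)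
    IH = go (isolate H v) (isolate-subcubic {G = H} sub) (rec smaller)
    open Extend H v act (proj₁ IH)
  -- Now d ≤ k at every active vertex, which rules out active vertices altogether.
  ... | no none = empty idle , ≤-trans (≤-reflexive (cong (2 *_) (sum-replicate-zero n))) z≤n
    where
    idle : ∀ u → ¬ Active H u
    idle = SubcubicGraph.crowded⇒inactive H sub
      (λ v act → ≮⇒≥ (λ k<d → none (v , act , k<d)))

-- Connected graphs with d ≤ 1 + k

bool-ext : ∀ {b c} → (b ≡ true → c ≡ true) → (c ≡ true → b ≡ true) → b ≡ c
bool-ext {true}          f g = ≡-sym (f refl)
bool-ext {false} {true}  f g = g refl
bool-ext {false} {false} f g = refl

-- The image of e is closed under adjacency, hence everything when G is connected.
embedding⇒≅ : ∀ {m n} (G : Graph n) (H : Graph m) → Connected G → Fin m → (e : Fin m → Fin n) →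
  (∀ {i j} → e i ≡ e j → i ≡ j) → (∀ i j → Adj H i j → Adj G (e i) (e j)) →
  (∀ i x → Adj G (e i) x → ∃ λ j → e j ≡ x × Adj H i j) → G ≅ H
embedding⇒≅ G H conn i₀ e inj pres refl-adj =
  mk↔ₛ′ to e (λ j → inj (e∘to (e j))) e∘to , λ u v → bool-ext (fwd u v) (bwd u v)
  where
  reach : ∀ {x y} → Reach G x y → (∃ λ j → e j ≡ x) → ∃ λ j → e j ≡ y
  reach here          p          = p
  reach (step xy r) (j , refl) with refl-adj j _ xy
  ... | k , ek , _ = reach r (k , ek)
  surj : ∀ y → ∃ λ j → e j ≡ y
  surj y = reach (conn (e i₀) y) (i₀ , refl)
  to = λ y → proj₁ (surj y)
  e∘to : ∀ y → e (to y) ≡ y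
  e∘to y = proj₂ (surj y)
  fwd : ∀ u v → Adj G u v → Adj H (to u) (to v)
  fwd u v uv with refl-adj (to u) v (subst (λ w → Adj G w v) (≡-sym (e∘to u)) uv)
  ... | j , ej , a = subst (Adj H (to u)) (inj (trans ej (≡-sym (e∘to v)))) a
  bwd : ∀ u v → Adj H (to u) (to v) → Adj G u v
  bwd u v a = subst₂ (Adj G) (e∘to u) (e∘to v) (pres _ _ a)

lookup-injective : ∀ {A : Set} {xs : List A} → Unique xs → ∀ {i j} → lookup xs i ≡ lookup xs j → i ≡ j
lookup-injective (_ ∷ _)   {zero}  {zero}  _  = refl
lookup-injective (x∉ ∷ _) {zero}  {suc j} eq = contradiction eq (All.lookup x∉ (∈-lookup j))
lookup-injective (x∉ ∷ _) {suc i} {zero}  eq = contradiction (≡-sym eq) (All.lookup x∉ (∈-lookup i))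
lookup-injective (_ ∷ q)   {suc i} {suc j} eq = cong suc (lookup-injective q eq)

NbrTable : ∀ {m} → Graph m → (Fin m → List (Fin m)) → Set
NbrTable H N = ∀ i j → adj H i j ≡ ⌊ mem? _≟_ j (N i) ⌋

nbrTable? : ∀ {m} (H : Graph m) N → Dec (NbrTable H N)
nbrTable? H N = all? λ i → all? λ j → adj H i j Bool.≟ ⌊ mem? _≟_ j (N i) ⌋

-- Reduces an isomorphism with a fixed small graph to a list of distinct vertices with their
-- complete neighbourhoods. The implicit argument has the table of `H` checked by evaluation.
labelling⇒≅ : ∀ {n} (G : Graph n) → Connected G → ∀ v vs (H : Graph (length (v ∷ vs))) N →
  {True (nbrTable? H N)} → Unique (v ∷ vs) →
  (∀ i → Nbrs G (lookup (v ∷ vs) i) (map (lookup (v ∷ vs)) (N i))) → G ≅ H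
labelling⇒≅ G conn v vs H N {ok} uniq nb =
  embedding⇒≅ G H conn zero e (lookup-injective uniq)
    (λ i j ij → All.lookup (Nbrs.each (nb i))
      (∈-map⁺ e (⌊⌋-holds (mem? _≟_ j (N i)) (trans (≡-sym (table i j)) ij))))
    λ i x ix → back i x (∈-map⁻ e (Nbrs.only (nb i) x ix))
  where
  e = lookup (v ∷ vs)
  table : NbrTable H N
  table = toWitness ok
  back : ∀ i x → (∃ λ j → j ∈ˡ N i × x ≡ e j) → ∃ λ j → e j ≡ x × Adj H i j
  back i x (j , j∈ , x≡) = j , ≡-sym x≡ , trans (table i j) (⌊⌋-true (mem? _≟_ j (N i)) j∈)

-- The tables list neighbours in the order in which the structure proofs produce them.
N₁ : Fin 4 → List (Fin 4)
N₁ 0F = 2F ∷ 3F ∷ []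
N₁ 1F = 2F ∷ 3F ∷ []
N₁ 2F = 0F ∷ 1F ∷ []
N₁ 3F = 0F ∷ 1F ∷ []

N₂ N₃ N₄ N₅ : Fin 6 → List (Fin 6)
N₂ 0F = 3F ∷ 4F ∷ 5F ∷ []
N₂ 1F = 3F ∷ 4F ∷ 5F ∷ []
N₂ 2F = 3F ∷ 4F ∷ 5F ∷ []
N₂ 3F = 0F ∷ 1F ∷ 2F ∷ []
N₂ 4F = 0F ∷ 1F ∷ 2F ∷ []
N₂ 5F = 0F ∷ 1F ∷ 2F ∷ []

N₃ 0F = 2F ∷ 3F ∷ 4F ∷ []
N₃ 1F = 2F ∷ 3F ∷ 4F ∷ []
N₃ 2F = 5F ∷ 0F ∷ 1F ∷ []
N₃ 3F = 0F ∷ 1F ∷ []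
N₃ 4F = 0F ∷ 1F ∷ []
N₃ 5F = 2F ∷ []

N₄ 0F = 2F ∷ 3F ∷ 1F ∷ []
N₄ 1F = 0F ∷ 4F ∷ 5F ∷ []
N₄ 2F = 0F ∷ []
N₄ 3F = 0F ∷ []
N₄ 4F = 1F ∷ []
N₄ 5F = 1F ∷ []

N₅ 0F = 1F ∷ []
N₅ 1F = 0F ∷ 2F ∷ 4F ∷ []
N₅ 2F = 1F ∷ 3F ∷ []
N₅ 3F = 2F ∷ 4F ∷ []
N₅ 4F = 1F ∷ 3F ∷ 5F ∷ []
N₅ 5F = 4F ∷ []

-- Leaves, supports and the exceptional graphs.

module Critical {n} (G : Graph n) (sub : Subcubic G) (no-isolated : NoIsolated G)
  (connected : Connected G) (critical : ∀ v → deg G v ≤ 1 + captives G v) where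

  open SubcubicGraph G sub

  LeafOf : Fin n → Fin n → Set
  LeafOf u l = Nbrs G l (u ∷ [])

  Leaf : Fin n → Set
  Leaf l = ∃ λ u → LeafOf u l

  Support : Fin n → Set
  Support u = ∃ (LeafOf u)

  leaf-adj : ∀ {u l} → LeafOf u l → u ~ l
  leaf-adj (nbrs _ (lu ∷ []) _) = ~-sym lu

  no-leaf-two : ∀ {v a b} → Nbrs G v (a ∷ b ∷ []) → ¬ Leaf v
  no-leaf-two (nbrs ((a≢b ∷ []) ∷ _) (va ∷ vb ∷ []) _) (u , L) =
    a≢b (trans (leaf-nbr L va) (≡-sym (leaf-nbr L vb)))

  no-leaf-three : ∀ {v a b c} → Nbrs G v (a ∷ b ∷ c ∷ []) → ¬ Leaf v
  no-leaf-three (nbrs ((a≢b ∷ _) ∷ _) (va ∷ vb ∷ _) _) (u , L) =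
    a≢b (trans (leaf-nbr L va) (≡-sym (leaf-nbr L vb)))

  leaf? : ∀ v → Dec (Leaf v)
  leaf? v with view v (no-isolated v)
  ... | one a N       = yes (a , N)
  ... | two _ _ N     = no (no-leaf-two N)
  ... | three _ _ _ N = no (no-leaf-three N)

  leafOf? : ∀ u l → Dec (LeafOf u l)
  leafOf? u l with leaf? l
  ... | no ¬L = no (λ L → ¬L (u , L))
  ... | yes (u′ , L) with u ≟ u′
  ... | yes refl = yes L
  ... | no  u≢u′ = no (λ L′ → u≢u′ (leaf-nbr L (~-sym (leaf-adj L′))))

  support? : ∀ u → Dec (Support u)
  support? u = any? (leafOf? u)

  leaves-≢ : ∀ {u u′ l l′} → LeafOf u l → LeafOf u′ l′ → u ≢ u′ → l ≢ l′
  leaves-≢ L L′ u≢u′ refl = u≢u′ (leaf-nbr L′ (~-sym (leaf-adj L)))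

  -- From d ≤ 1 + k: a vertex of degree d has at least d - 1 captives.
  k₂ : ∀ {v a b} → Nbrs G v (a ∷ b ∷ []) → ∃ (Captive G v)
  k₂ {v} (nbrs q s _) = captive₁ (s≤s⁻¹ (≤-trans (length≤deg q s) (critical v)))

  k₃ : ∀ {v a b c} → Nbrs G v (a ∷ b ∷ c ∷ []) → ∃₂ λ p q → p ≢ q × Captive G v p × Captive G v q
  k₃ {v} (nbrs q s _) = captive₂ (s≤s⁻¹ (≤-trans (length≤deg q s) (critical v)))

  -- A captive is active and all its neighbours are neighbours of `v`; with `a` excluded, only `b`
  -- is left.
  sole₂ : ∀ {v p a b} → Captive G v p → Nbrs G v (a ∷ b ∷ []) → ¬ p ~ a → LeafOf b p
  sole₂ {v} {p} {a} {b} (_ , (x , px) , ⊆) N ¬a = nbrs₁ (subst (p ~_) (is-b px) px) (λ _ → is-b)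
    where
    is-b : ∀ {y} → p ~ y → y ≡ b
    is-b py with Nbrs.only N _ (⊆ _ py)
    ... | here refl         = contradiction py ¬a
    ... | there (here refl) = refl

  sole₃ : ∀ {v p a b c} → Captive G v p → Nbrs G v (a ∷ b ∷ c ∷ []) →
    ¬ p ~ a → ¬ p ~ b → LeafOf c p
  sole₃ {v} {p} {a} {b} {c} (_ , (x , px) , ⊆) N ¬a ¬b = nbrs₁ (subst (p ~_) (is-c px) px) (λ _ → is-c)
    where
    is-c : ∀ {y} → p ~ y → y ≡ c
    is-c py with Nbrs.only N _ (⊆ _ py)
    ... | here refl                 = contradiction py ¬a
    ... | there (here refl)         = contradiction py ¬b
    ... | there (there (here refl)) = refl

  module Leafless (leafless : ∀ v → ¬ Leaf v) where

    -- Without leaves the captive `p` has neighbourhood {a, b}. Suppose `a` had a third neighbour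
    -- `z`. Each of its two captives would touch `v` or `p`, and so be `b`, or else be a leaf at
    -- `z`; distinct captives cannot both be `b`. The same holds with `a` and `b` exchanged.
    square : ∀ {v a b} → Nbrs G v (a ∷ b ∷ []) → G ≅ G1
    square {v} {a} {b} Nv@(nbrs ((a≢b ∷ []) ∷ _) (va ∷ vb ∷ []) only) with k₂ Nv
    ... | p , Kp@(p≢v , p-act , ⊆) = labelling⇒≅ G connected v (p ∷ a ∷ b ∷ []) G1 N₁
      ((≢-sym p≢v ∷ ~⇒≢ va ∷ ~⇒≢ vb ∷ []) ∷ (~⇒≢ pa ∷ ~⇒≢ pb ∷ []) ∷ (a≢b ∷ []) ∷ [] ∷ [])
      λ { 0F → Nv ; 1F → Np
        ; 2F → side va pa (λ { (here e) → inj₁ e ; (there (here e)) → inj₂ e })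
        ; 3F → side vb pb (λ { (here e) → inj₂ e ; (there (here e)) → inj₁ e }) }
      where
      deg≤ : deg G v ≤ deg G p
      deg≤ = ≤-trans (Nbrs⇒deg≤ Nv) (2≤deg p-act (λ a N → leafless p (a , N)))
      pa = twin Kp deg≤ va
      pb = twin Kp deg≤ vb
      Np : Nbrs G p (a ∷ b ∷ [])
      Np = nbrs ((a≢b ∷ []) ∷ [] ∷ []) (pa ∷ pb ∷ []) (λ x px → only x (⊆ x px))
      side : ∀ {c d} → v ~ c → p ~ c →
        (∀ {x} → x ∈ˡ (a ∷ b ∷ []) → x ≡ c ⊎ x ≡ d) → Nbrs G c (v ∷ p ∷ [])
      side {c} {d} va pa cover with view c (no-isolated c)
      ... | one x N = contradiction (x , N) (leafless c)
      ... | two _ _ N = nbrs₂ N (≢-sym p≢v) (~-sym va) (~-sym pa)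
      ... | three _ _ _ N with third N (≢-sym p≢v) (~-sym va) (~-sym pa)
      ... | z , Nc with k₃ Nc
      ... | r , r′ , r≢r′ , K , K′ = contradiction (trans (is-d K) (≡-sym (is-d K′))) r≢r′
        where
        common : ∀ {r} → r ≢ c → v ~ r → r ≡ d
        common r≢c vr with cover (only _ vr)
        ... | inj₁ e = contradiction e r≢c
        ... | inj₂ e = e
        is-d : ∀ {r} → Captive G c r → r ≡ d
        is-d {r} K@(r≢c , _) with adj? G r v | adj? G r p
        ... | yes rv | _      = common r≢c (~-sym rv)
        ... | no _   | yes rp = common r≢c (⊆ _ (~-sym rp))
        ... | no ¬rv | no ¬rp = contradiction (z , sole₃ K Nc ¬rv ¬rp) (leafless r)

    -- All degrees are three, so both captives of `v` share its neighbourhood, and each neighbour of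
    -- `v` is saturated by `v` and these two.
    cubic : (∀ {v a b} → ¬ Nbrs G v (a ∷ b ∷ [])) → Fin n → G ≅ G2
    cubic ¬two v with view v (no-isolated v)
    ... | one a N   = contradiction (a , N) (leafless v)
    ... | two _ _ N = ⊥-elim (¬two N)
    ... | three a b c Nv@(nbrs ((a≢b ∷ a≢c ∷ []) ∷ (b≢c ∷ []) ∷ _) (va ∷ vb ∷ vc ∷ []) _) with k₃ Nv
    ... | p , q , p≢q , Kp , Kq = labelling⇒≅ G connected v (p ∷ q ∷ a ∷ b ∷ c ∷ []) G2 N₂
      ( (v≢p ∷ v≢q ∷ ~⇒≢ va ∷ ~⇒≢ vb ∷ ~⇒≢ vc ∷ [])
      ∷ (p≢q ∷ ~⇒≢ (to Kp va) ∷ ~⇒≢ (to Kp vb) ∷ ~⇒≢ (to Kp vc) ∷ [])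
      ∷ (~⇒≢ (to Kq va) ∷ ~⇒≢ (to Kq vb) ∷ ~⇒≢ (to Kq vc) ∷ [])
      ∷ (a≢b ∷ a≢c ∷ []) ∷ (b≢c ∷ []) ∷ [] ∷ [])
      λ { 0F → Nv ; 1F → left Kp ; 2F → left Kq ; 3F → right va ; 4F → right vb ; 5F → right vc }
      where
      v≢p = ≢-sym (proj₁ Kp)
      v≢q = ≢-sym (proj₁ Kq)
      3≤deg : ∀ w → 3 ≤ deg G w
      3≤deg w with view w (no-isolated w)
      ... | one x N                   = contradiction (x , N) (leafless w)
      ... | two _ _ N                 = ⊥-elim (¬two N)
      ... | three _ _ _ (nbrs q s _) = length≤deg q s
      to : ∀ {r x} → Captive G v r → v ~ x → r ~ x
      to {r} K = twin K (≤-trans (sub v) (3≤deg r))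
      left : ∀ {r} → Captive G v r → Nbrs G r (a ∷ b ∷ c ∷ [])
      left K = nbrs₃ a≢b a≢c b≢c (to K va) (to K vb) (to K vc)
      right : ∀ {x} → v ~ x → Nbrs G x (v ∷ p ∷ q ∷ [])
      right vx = nbrs₃ v≢p v≢q p≢q (~-sym vx) (~-sym (to Kp vx)) (~-sym (to Kq vx))

  -- A captive of `v` touches neither `x` nor `y`, since their only neighbour is `v`. Hence `v` has
  -- a third neighbour `z`, and both captives are leaves at `z`.
  double-star : ∀ {v x y} → x ≢ y → LeafOf v x → LeafOf v y → G ≅ G4
  double-star {v} {x} {y} x≢y Lx Ly with view v (no-isolated v)
  ... | one a N = contradiction
    (trans (leaf-nbr N (leaf-adj Lx)) (≡-sym (leaf-nbr N (leaf-adj Ly)))) x≢y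
  ... | two _ _ N with nbrs₂ N x≢y (leaf-adj Lx) (leaf-adj Ly)
  ... | Nv with k₂ Nv
  ... | p , K@(p≢v , _) = contradiction
    (leaf-captive Ly (~-sym (leaf-adj (sole₂ K Nv (λ px → p≢v (leaf-captive Lx px)))))) p≢v
  double-star {v} {x} {y} x≢y Lx Ly | three _ _ _ N with third N x≢y (leaf-adj Lx) (leaf-adj Ly)
  ... | z , Nv@(nbrs ((_ ∷ x≢z ∷ []) ∷ (y≢z ∷ []) ∷ _) (vx ∷ vy ∷ vz ∷ []) _) with k₃ Nv
  ... | p , q , p≢q , Kp , Kq = labelling⇒≅ G connected v (z ∷ x ∷ y ∷ p ∷ q ∷ []) G4 N₄
    ( (~⇒≢ vz ∷ ~⇒≢ vx ∷ ~⇒≢ vy ∷ ≢-sym (proj₁ Kp) ∷ ≢-sym (proj₁ Kq) ∷ [])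
    ∷ (≢-sym x≢z ∷ ≢-sym y≢z ∷ ~⇒≢ (leaf-adj Lp) ∷ ~⇒≢ (leaf-adj Lq) ∷ [])
    ∷ (x≢y ∷ leaves-≢ Lx Lp (~⇒≢ vz) ∷ leaves-≢ Lx Lq (~⇒≢ vz) ∷ [])
    ∷ (leaves-≢ Ly Lp (~⇒≢ vz) ∷ leaves-≢ Ly Lq (~⇒≢ vz) ∷ [])
    ∷ (p≢q ∷ []) ∷ [] ∷ [])
    λ { 0F → Nv
      ; 1F → nbrs₃ (≢-sym (proj₁ Kp)) (≢-sym (proj₁ Kq)) p≢q (~-sym vz) (leaf-adj Lp) (leaf-adj Lq)
      ; 2F → Lx ; 3F → Ly ; 4F → Lp ; 5F → Lq }
    where
    leaf : ∀ {p} → Captive G v p → LeafOf z p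
    leaf K@(p≢v , _) = sole₃ K Nv (λ px → p≢v (leaf-captive Lx px)) (λ py → p≢v (leaf-captive Ly py))
    Lp = leaf Kp
    Lq = leaf Kq

  module SingleLeaves (single : ∀ {u x y} → LeafOf u x → LeafOf u y → x ≡ y) where

    module Exceptional {u l v} (Ll : LeafOf u l) (uv : u ~ v) (¬leaf : ¬ Leaf v) (¬support : ¬ Support v) where

      private
        l≢v : l ≢ v
        l≢v refl = ¬leaf (u , Ll)

        -- Such a `p` avoids the leaf `l`, so its neighbours are among `v` and `w`. It cannot have
        -- `v` alone, for then `v` would be a support.
        captive-of-u : ∀ {w p} → Nbrs G u (l ∷ v ∷ w ∷ []) → Captive G u p →
          LeafOf w p ⊎ Nbrs G p (v ∷ w ∷ [])
        captive-of-u {w} {p} Nu@(nbrs (_ ∷ (v≢w ∷ []) ∷ _) _ only) K@(p≢u , _ , ⊆)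
          with adj? G p v | adj? G p w
        ... | no ¬v  | _      = inj₁ (sole₃ K Nu (λ pl → p≢u (leaf-captive Ll pl)) ¬v)
        ... | yes pv | no ¬w  = contradiction (p , nbrs₁ pv is-v) ¬support
          where
          is-v : ∀ x → p ~ x → x ≡ v
          is-v x px with only x (⊆ x px)
          ... | here refl                 = contradiction (leaf-captive Ll px) p≢u
          ... | there (here refl)         = refl
          ... | there (there (here refl)) = contradiction px ¬w
        ... | yes pv | yes pw = inj₂ (nbrs ((v≢w ∷ []) ∷ [] ∷ []) (pv ∷ pw ∷ []) in-vw)
          where
          in-vw : ∀ x → p ~ x → x ∈ˡ (v ∷ w ∷ [])
          in-vw x px with only x (⊆ x px)
          ... | here refl = contradiction (leaf-captive Ll px) p≢u
          ... | there x∈  = x∈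

        -- The parts of the K_{2,3} are {v, w} and {u, p, q}, and `l` is the pendant vertex at `u`.
        -- Three neighbours saturate `v` and `w`.
        K₂₃-pendant : ∀ {w p q} → Nbrs G u (l ∷ v ∷ w ∷ []) → p ≢ q → p ≢ u → q ≢ u →
          Nbrs G p (v ∷ w ∷ []) → Nbrs G q (v ∷ w ∷ []) → G ≅ G3
        K₂₃-pendant {w} {p} {q} Nu@(nbrs (_ ∷ (v≢w ∷ []) ∷ _) (ul ∷ _ ∷ uw ∷ []) _) p≢q p≢u q≢u
          Np@(nbrs _ (pv ∷ pw ∷ []) _) Nq@(nbrs _ (qv ∷ qw ∷ []) _) =
          labelling⇒≅ G connected v (w ∷ u ∷ p ∷ q ∷ l ∷ []) G3 N₃
          ( (v≢w ∷ ~⇒≢ (~-sym uv) ∷ ~⇒≢ (~-sym pv) ∷ ~⇒≢ (~-sym qv) ∷ ≢-sym l≢v ∷ [])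
          ∷ (~⇒≢ (~-sym uw) ∷ ~⇒≢ (~-sym pw) ∷ ~⇒≢ (~-sym qw)
              ∷ ≁⇒≢ (~-sym pw) (λ lp → p≢u (leaf-nbr Ll lp)) ∷ [])
          ∷ (≢-sym p≢u ∷ ≢-sym q≢u ∷ ~⇒≢ ul ∷ [])
          ∷ (p≢q ∷ not-l Np ∷ []) ∷ (not-l Nq ∷ []) ∷ [] ∷ [])
          λ { 0F → nbrs₃ (≢-sym p≢u) (≢-sym q≢u) p≢q (~-sym uv) (~-sym pv) (~-sym qv)
            ; 1F → nbrs₃ (≢-sym p≢u) (≢-sym q≢u) p≢q (~-sym uw) (~-sym pw) (~-sym qw)
            ; 2F → Nu ; 3F → Np ; 4F → Nq ; 5F → Ll }
          where
          not-l : ∀ {r} → Nbrs G r (v ∷ w ∷ []) → r ≢ l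
          not-l N refl = no-leaf-two N (u , Ll)

        -- The 4-cycle is u, v, p, w, with leaves `l` and `q` at its adjacent vertices `u` and `w`.
        -- Only the degree of `v` remains open: degree two gives `G5`, and a third neighbour is
        -- refuted.
        square-pendants : ∀ {w p q} → Nbrs G u (l ∷ v ∷ w ∷ []) → p ≢ q → p ≢ u → q ≢ u →
          Nbrs G p (v ∷ w ∷ []) → LeafOf w q → G ≅ G5
        square-pendants {w} {p} {q} Nu@(nbrs (_ ∷ (v≢w ∷ []) ∷ _) (ul ∷ _ ∷ uw ∷ []) only-u) p≢q p≢u q≢u
          Np@(nbrs _ (pv ∷ pw ∷ []) only-p) Lq = from-view (view v (no-isolated v))
          where
          Nw : Nbrs G w (u ∷ p ∷ q ∷ [])
          Nw = nbrs₃ (≢-sym p≢u) (≢-sym q≢u) p≢q (~-sym uw) (~-sym pw) (leaf-adj Lq)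
          ¬vq : ¬ v ~ q
          ¬vq vq = v≢w (leaf-captive Lq vq)
          from-view : View v → G ≅ G5
          from-view (one a N) = contradiction (a , N) ¬leaf
          from-view (two _ _ N) = labelling⇒≅ G connected l (u ∷ v ∷ p ∷ w ∷ q ∷ []) G5 N₅
            ( (~⇒≢ (~-sym ul) ∷ l≢v ∷ ≢-sym (not-leaf Np Ll)
                ∷ (λ { refl → no-leaf-three Nw (u , Ll) }) ∷ leaves-≢ Ll Lq (~⇒≢ uw) ∷ [])
            ∷ (~⇒≢ uv ∷ ≢-sym p≢u ∷ ~⇒≢ uw ∷ ≢-sym q≢u ∷ [])
            ∷ (~⇒≢ (~-sym pv) ∷ v≢w ∷ (λ { refl → ¬leaf (w , Lq) }) ∷ [])
            ∷ (~⇒≢ pw ∷ p≢q ∷ []) ∷ (~⇒≢ (leaf-adj Lq) ∷ []) ∷ [] ∷ [])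
            λ { 0F → Ll ; 1F → Nu ; 2F → nbrs₂ N (≢-sym p≢u) (~-sym uv) (~-sym pv)
              ; 3F → Np ; 4F → Nw ; 5F → Lq }
            where
            not-leaf : ∀ {r x} → Nbrs G r (v ∷ w ∷ []) → LeafOf u x → r ≢ x
            not-leaf N L refl = no-leaf-two N (u , L)
          from-view (three _ _ _ N) with third N (≢-sym p≢u) (~-sym uv) (~-sym pv)
          ... | z , Nv@(nbrs ((_ ∷ u≢z ∷ []) ∷ (p≢z ∷ []) ∷ _) (_ ∷ _ ∷ vz ∷ []) only-v) = impossible
            where
            -- A captive of `v` cannot be `w`, because `w` has the neighbour `q` and `v` does not.
            -- So touching `u` leaves only `l`, touching `p` leaves nothing, and touching neither
            -- makes it a leaf at `z`.
            captive-of-v : ∀ {r} → Captive G v r → r ≡ l ⊎ LeafOf z r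
            captive-of-v {r} K@(r≢v , _ , ⊆) with adj? G r u | adj? G r p
            ... | no ¬u | no ¬p = inj₂ (sole₃ K Nv ¬u ¬p)
            ... | yes ru | _ with only-u r (~-sym ru)
            ... | here r≡l                  = inj₁ r≡l
            ... | there (here r≡v)          = contradiction r≡v r≢v
            ... | there (there (here refl)) = contradiction (⊆ q (leaf-adj Lq)) ¬vq
            captive-of-v {r} K@(r≢v , _ , ⊆) | no _ | yes rp with only-p r (~-sym rp)
            ... | here r≡v          = contradiction r≡v r≢v
            ... | there (here refl) = contradiction (⊆ q (leaf-adj Lq)) ¬vq

            -- Two distinct captives of `v` are not both `l`, so one of them is a leaf at `z`.
            z-support : ∃ (LeafOf z)
            z-support with k₃ Nv
            ... | r , r′ , r≢r′ , K , K′ with captive-of-v K | captive-of-v K′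
            ... | inj₂ L   | _         = r , L
            ... | inj₁ _   | inj₂ L    = r′ , L
            ... | inj₁ r≡l | inj₁ r′≡l = contradiction (trans r≡l (≡-sym r′≡l)) r≢r′

            -- It would have to be `u` or `p`; then `z` would be adjacent to `l` or to `w`, whose
            -- neighbourhoods are already complete.
            ¬captive-v : ∀ {s} → Captive G z s → ¬ s ~ v
            ¬captive-v {s} (s≢z , _ , ⊆) sv with only-v s (~-sym sv)
            ... | here refl                = u≢z (≡-sym (leaf-nbr Ll (~-sym (⊆ l ul))))
            ... | there (there (here s≡z)) = s≢z s≡z
            ... | there (here refl) with Nbrs.only Nw z (~-sym (⊆ w pw))
            ... | here z≡u                 = u≢z (≡-sym z≡u)
            ... | there (here z≡p)         = p≢z (≡-sym z≡p)
            ... | there (there (here refl)) = ¬vq vz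

            -- Captives of `z` touch neither `v` nor the leaf `r`. With degree two nothing is left
            -- for them; with degree three both would be leaves at the same vertex `t`, against
            -- `single`.
            refute : ∀ {r} → LeafOf z r → v ≢ r → ⊥
            refute Lr v≢r with view z (no-isolated z)
            ... | one a N = contradiction
              (trans (leaf-nbr N (~-sym vz)) (≡-sym (leaf-nbr N (leaf-adj Lr)))) v≢r
            ... | two _ _ N with nbrs₂ N v≢r (~-sym vz) (leaf-adj Lr)
            ... | Nz with k₂ Nz
            ... | s , K = contradiction
              (leaf-captive Lr (~-sym (leaf-adj (sole₂ K Nz (¬captive-v K))))) (proj₁ K)
            refute Lr v≢r | three _ _ _ N with third N v≢r (~-sym vz) (leaf-adj Lr)
            ... | t , Nz with k₃ Nz
            ... | s , s′ , s≢s′ , K , K′ = contradiction (single (leaf K) (leaf K′)) s≢s′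
              where
              leaf : ∀ {s} → Captive G z s → LeafOf t s
              leaf K@(s≢z , _) = sole₃ K Nz (¬captive-v K) (λ sr → s≢z (leaf-captive Lr sr))

            impossible : G ≅ G5
            impossible with z-support
            ... | r , Lr = ⊥-elim (refute Lr λ { refl → ¬leaf (z , Lr) })

      -- If `u` had only the neighbours `l` and `v`, its captive would be a leaf at `v`. So `u` has
      -- a third neighbour `w` and two captives, and by `single` at most one of them is a leaf at
      -- `w`.
      exceptional : G ≅ G3 ⊎ G ≅ G5
      exceptional with view u (no-isolated u)
      ... | one a N = contradiction (trans (leaf-nbr N (leaf-adj Ll)) (≡-sym (leaf-nbr N uv))) l≢v
      ... | two _ _ N with nbrs₂ N l≢v (leaf-adj Ll) uv
      ... | Nu with k₂ Nu
      ... | p , K = contradiction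
        (p , sole₂ K Nu (λ pl → proj₁ K (leaf-captive Ll pl))) ¬support
      exceptional | three _ _ _ N with third N l≢v (leaf-adj Ll) uv
      ... | w , Nu with k₃ Nu
      ... | p , q , p≢q , Kp , Kq with captive-of-u Nu Kp | captive-of-u Nu Kq
      ... | inj₁ Lp | inj₁ Lq = contradiction (single Lp Lq) p≢q
      ... | inj₁ Lp | inj₂ Nq = inj₂ (square-pendants Nu (≢-sym p≢q) (proj₁ Kq) (proj₁ Kp) Nq Lp)
      ... | inj₂ Np | inj₁ Lq = inj₂ (square-pendants Nu p≢q (proj₁ Kp) (proj₁ Kq) Np Lq)
      ... | inj₂ Np | inj₂ Nq = inj₁ (K₂₃-pendant Nu p≢q (proj₁ Kp) (proj₁ Kq) Np Nq)

-- Coronas of paths and cycles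

==-true : ∀ {n} {u v : Fin n} → u == v ≡ true → u ≡ v
==-true {u = u} {v} e = toℕ-injective (≡ᵇ⇒≡ (toℕ u) (toℕ v) (Equivalence.from T-≡ e))

==-refl : ∀ {n} (u : Fin n) → u == u ≡ true
==-refl u = Equivalence.to T-≡ (≡⇒≡ᵇ (toℕ u) (toℕ u) refl)

mkGraph-adj⁻ : ∀ {n} (e : Fin n → Fin n → Bool) u v → Adj (mkGraph e) u v →
  e u v ≡ true ⊎ e v u ≡ true
mkGraph-adj⁻ e u v a with u == v | e u v
... | false | true  = inj₁ refl
... | false | false = inj₂ a

mkGraph-adj⁺ : ∀ {n} (e : Fin n → Fin n → Bool) u v → u ≢ v →
  e u v ≡ true ⊎ e v u ≡ true → Adj (mkGraph e) u v
mkGraph-adj⁺ e u v u≢v h with u == v in eq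
... | true = contradiction (==-true eq) u≢v
... | false with e u v | h
... | true  | _      = refl
... | false | inj₂ h = h

-- Adjacency in `cor F` read on the sum type, so that later proofs split on core vertex and leaf
-- without unfolding `mkGraph`.
CorEdge : ∀ {k} → Graph k → Fin k ⊎ Fin k → Fin k ⊎ Fin k → Set
CorEdge F (inj₁ i) (inj₁ j) = Adj F i j
CorEdge F (inj₁ i) (inj₂ j) = i ≡ j
CorEdge F (inj₂ i) (inj₁ j) = i ≡ j
CorEdge F (inj₂ i) (inj₂ j) = ⊥

cor-adj⁻ : ∀ {k} (F : Graph k) u v → Adj (cor F) u v → CorEdge F (splitAt k u) (splitAt k v)
cor-adj⁻ {k} F u v a with u == v | splitAt k u | splitAt k v | a
... | false | inj₁ i | inj₁ j | h with ∨-elim h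
...   | inj₁ ij = ij
...   | inj₂ ji = trans (sym F i j) ji
cor-adj⁻ {k} F u v a | false | inj₁ i | inj₂ j | h = [ ==-true , ≡-sym ∘ ==-true ]′ (∨-elim h)
cor-adj⁻ {k} F u v a | false | inj₂ i | inj₁ j | h = [ ==-true , ≡-sym ∘ ==-true ]′ (∨-elim h)

cor-adj⁺ : ∀ {k} (F : Graph k) u v → CorEdge F (splitAt k u) (splitAt k v) → Adj (cor F) u v
cor-adj⁺ {k} F u v c with u == v in eq
... | true with refl ← ==-true {u = u} {v} eq = ⊥-elim (irr (splitAt k u) c)
  where
  irr : ∀ s → ¬ CorEdge F s s
  irr (inj₁ i) ii with () ← trans (≡-sym ii) (irrefl F i)
... | false with splitAt k u | splitAt k v | c
... | inj₁ i | inj₁ j | ij   = ∨-introˡ ij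
... | inj₁ i | inj₂ _ | refl = ∨-introˡ (==-refl i)
... | inj₂ i | inj₁ _ | refl = ∨-introˡ (==-refl i)

≡ᵇ-true : ∀ m n → (m ≡ᵇ n) ≡ true → m ≡ n
≡ᵇ-true m n e = ≡ᵇ⇒≡ m n (Equivalence.from T-≡ e)

true-≡ᵇ : ∀ {m n} → m ≡ n → (m ≡ᵇ n) ≡ true
true-≡ᵇ {m} {n} e = Equivalence.to T-≡ (≡⇒≡ᵇ m n e)

Consecutive : ℕ → ℕ → Set
Consecutive a b = b ≡ suc a ⊎ a ≡ suc b

path-step : ∀ {k} → Fin k → Fin k → Bool
path-step i j = toℕ j ≡ᵇ suc (toℕ i)

path-adj⁻ : ∀ {k} {i j : Fin k} → Adj (PathG k) i j → Consecutive (toℕ i) (toℕ j)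
path-adj⁻ {i = i} {j} a with mkGraph-adj⁻ path-step i j a
... | inj₁ e = inj₁ (≡ᵇ-true _ _ e)
... | inj₂ e = inj₂ (≡ᵇ-true _ _ e)

consecutive-≢ : ∀ {k} {i j : Fin k} → Consecutive (toℕ i) (toℕ j) → i ≢ j
consecutive-≢ (inj₁ e) refl = 1+n≢n (≡-sym e)
consecutive-≢ (inj₂ e) refl = 1+n≢n (≡-sym e)

path-adj⁺ : ∀ {k} {i j : Fin k} → Consecutive (toℕ i) (toℕ j) → Adj (PathG k) i j
path-adj⁺ {i = i} {j} c = mkGraph-adj⁺ path-step i j (consecutive-≢ c) (edge c)
  where
  edge : Consecutive (toℕ i) (toℕ j) → _
  edge (inj₁ e) = inj₁ (true-≡ᵇ e)
  edge (inj₂ e) = inj₂ (true-≡ᵇ e)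

Closing : ℕ → ℕ → ℕ → Set
Closing k a b = suc a ≡ k × b ≡ 0

CycleEdge : ℕ → ℕ → ℕ → Set
CycleEdge k a b = Consecutive a b ⊎ (Closing k a b ⊎ Closing k b a)

cycle-step : ∀ {k} → Fin k → Fin k → Bool
cycle-step {k} i j = (toℕ j ≡ᵇ suc (toℕ i)) ∨ ((suc (toℕ i) ≡ᵇ k) ∧ (toℕ j ≡ᵇ 0))

cycle-step⁻ : ∀ {k} a b → (b ≡ᵇ suc a) ∨ ((suc a ≡ᵇ k) ∧ (b ≡ᵇ 0)) ≡ true →
  b ≡ suc a ⊎ Closing k a b
cycle-step⁻ {k} a b e with Equivalence.to T-∨ (Equivalence.from T-≡ e)
... | inj₁ t = inj₁ (≡ᵇ⇒≡ b (suc a) t)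
... | inj₂ t with Equivalence.to T-∧ t
... | t₁ , t₂ = inj₂ (≡ᵇ⇒≡ (suc a) k t₁ , ≡ᵇ⇒≡ b 0 t₂)

cycle-step⁺ : ∀ {k} a b → b ≡ suc a ⊎ Closing k a b →
  (b ≡ᵇ suc a) ∨ ((suc a ≡ᵇ k) ∧ (b ≡ᵇ 0)) ≡ true
cycle-step⁺ a b (inj₁ e) = Equivalence.to T-≡ (Equivalence.from T-∨ (inj₁ (≡⇒≡ᵇ b (suc a) e)))
cycle-step⁺ {k} a b (inj₂ (e₁ , e₂)) = Equivalence.to T-≡ (Equivalence.from T-∨
  (inj₂ (Equivalence.from T-∧ (≡⇒≡ᵇ (suc a) k e₁ , ≡⇒≡ᵇ b 0 e₂))))

cycle-adj⁻ : ∀ {k} {i j : Fin k} → Adj (CycleG k) i j → CycleEdge k (toℕ i) (toℕ j)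
cycle-adj⁻ {i = i} {j} a with mkGraph-adj⁻ cycle-step i j a
... | inj₁ e with cycle-step⁻ (toℕ i) (toℕ j) e
...   | inj₁ c = inj₁ (inj₁ c)
...   | inj₂ c = inj₂ (inj₁ c)
cycle-adj⁻ {i = i} {j} a | inj₂ e with cycle-step⁻ (toℕ j) (toℕ i) e
...   | inj₁ c = inj₁ (inj₂ c)
...   | inj₂ c = inj₂ (inj₂ c)

-- For k = 1 the closing pair would be a loop, which `mkGraph` removes; `2 ≤ k` keeps its ends
-- apart.
cycle-adj⁺ : ∀ {k} {i j : Fin k} → 2 ≤ k → CycleEdge k (toℕ i) (toℕ j) → Adj (CycleG k) i j
cycle-adj⁺ {k} {i} {j} 2≤k c = mkGraph-adj⁺ cycle-step i j (distinct c) (edge c)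
  where
  closing-≢ : ∀ {i : Fin k} → ¬ Closing k (toℕ i) (toℕ i)
  closing-≢ {i} (e , z) = 1+n≰n (subst (2 ≤_) (≡-sym (trans (cong suc (≡-sym z)) e)) 2≤k)
  distinct : CycleEdge k (toℕ i) (toℕ j) → i ≢ j
  distinct (inj₁ c)        = consecutive-≢ c
  distinct (inj₂ (inj₁ c)) refl = closing-≢ {i} c
  distinct (inj₂ (inj₂ c)) refl = closing-≢ {i} c
  edge : CycleEdge k (toℕ i) (toℕ j) → _
  edge (inj₁ (inj₁ e)) = inj₁ (cycle-step⁺ {k} (toℕ i) (toℕ j) (inj₁ e))
  edge (inj₁ (inj₂ e)) = inj₂ (cycle-step⁺ {k} (toℕ j) (toℕ i) (inj₁ e))
  edge (inj₂ (inj₁ c)) = inj₁ (cycle-step⁺ {k} (toℕ i) (toℕ j) (inj₂ c))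
  edge (inj₂ (inj₂ c)) = inj₂ (cycle-step⁺ {k} (toℕ j) (toℕ i) (inj₂ c))

Extremal : ∀ {n} → Graph n → Set
Extremal {n} G =
  (G ≅ G1 ⊎ G ≅ G2 ⊎ G ≅ G3 ⊎ G ≅ G4 ⊎ G ≅ G5)
  ⊎ (Σ ℕ λ k → 1 ≤ k × n ≡ 2 * k × G ≅ cor (PathG k))
  ⊎ (Σ ℕ λ k → 3 ≤ k × n ≡ 2 * k × G ≅ cor (CycleG k))

≅cor⇒≡2* : ∀ {n k} (G : Graph n) (F : Graph k) → G ≅ cor F → n ≡ 2 * k
≅cor⇒≡2* {k = k} _ _ (f , _) = trans (↔⇒≡ f) (cong (k +_) (≡-sym (+-identityʳ k)))

-- From the subgraph of non-leaves (the core) to the corona.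

module CriticalStructure {n} (G : Graph n) (sub : Subcubic G) (no-isolated : NoIsolated G)
  (connected : Connected G) (critical : ∀ v → deg G v ≤ 1 + captives G v) where

  open SubcubicGraph G sub
  open Critical G sub no-isolated connected critical

  module Corona (single : ∀ {u x y} → LeafOf u x → LeafOf u y → x ≡ y)
    (supported : ∀ v → ¬ Leaf v → Support v) where

    -- The leaf copy of `i` goes to the leaf that `supported` gives at `c i`. By `single` this is
    -- the only leaf there, so closure under adjacency has to be checked only towards non-leaves.
    corona⇒≅ : ∀ {k} (F : Graph k) → Fin k → (c : Fin k → Fin n) → (∀ i → ¬ Leaf (c i)) →
      (∀ {i j} → c i ≡ c j → i ≡ j) → (∀ i j → Adj F i j → c i ~ c j) →
      (∀ i x → c i ~ x → ¬ Leaf x → ∃ λ j → c j ≡ x × Adj F i j) → G ≅ cor F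
    corona⇒≅ {k} F i₀ c core inj pres closed =
      embedding⇒≅ G (cor F) connected (i₀ ↑ˡ k) (place ∘ splitAt k)
        (λ {u} {v} e → trans (≡-sym (join-splitAt k k u))
          (trans (cong (join k k) (place-inj (splitAt k u) (splitAt k v) e)) (join-splitAt k k v)))
        (λ u v uv → place-adj (splitAt k u) (splitAt k v) (cor-adj⁻ F u v uv))
        (λ u x ux → back u x (place-closed (splitAt k u) x ux))
      where
      ℓ : Fin k → Fin n
      ℓ i = proj₁ (supported (c i) (core i))
      L : ∀ i → LeafOf (c i) (ℓ i)
      L i = proj₂ (supported (c i) (core i))
      place : Fin k ⊎ Fin k → Fin n
      place = [ c , ℓ ]′
      place-inj : ∀ s t → place s ≡ place t → s ≡ t
      place-inj (inj₁ i) (inj₁ j) e = cong inj₁ (inj e)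
      place-inj (inj₁ i) (inj₂ j) e = contradiction (_ , subst (LeafOf (c j)) (≡-sym e) (L j)) (core i)
      place-inj (inj₂ i) (inj₁ j) e = contradiction (_ , subst (LeafOf (c i)) e (L i)) (core j)
      place-inj (inj₂ i) (inj₂ j) e = cong inj₂ (inj (decidable-stable (c i ≟ c j)
        (λ ne → leaves-≢ (L i) (L j) ne e)))
      place-adj : ∀ s t → CorEdge F s t → place s ~ place t
      place-adj (inj₁ i) (inj₁ j) ij   = pres i j ij
      place-adj (inj₁ i) (inj₂ _) refl = leaf-adj (L i)
      place-adj (inj₂ i) (inj₁ _) refl = ~-sym (leaf-adj (L i))
      place-closed : ∀ s x → place s ~ x → ∃ λ t → place t ≡ x × CorEdge F s t
      place-closed (inj₂ i) x ix = inj₁ i , ≡-sym (leaf-nbr (L i) ix) , refl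
      place-closed (inj₁ i) x ix with leaf? x
      ... | no ¬leaf with closed i x ix ¬leaf
      ... | j , cj , ij = inj₁ j , cj , ij
      place-closed (inj₁ i) x ix | yes (u , Lx) =
        inj₂ i , single (L i) (subst (λ u → LeafOf u x) (≡-sym (leaf-nbr Lx (~-sym ix))) Lx) , refl
      back : ∀ u x → (∃ λ t → place t ≡ x × CorEdge F (splitAt k u) t) →
        ∃ λ v → place (splitAt k v) ≡ x × Adj (cor F) u v
      back u x (t , p , a) = join k k t , trans (cong place (splitAt-join k k t)) p ,
        cor-adj⁺ F u _ (subst (CorEdge F (splitAt k u)) (≡-sym (splitAt-join k k t)) a)

    -- The leaf at `v` occupies one of at most three places.
    core-two : ∀ {v x y z} → ¬ Leaf v → v ~ x → v ~ y → v ~ z → ¬ Leaf x → ¬ Leaf y → ¬ Leaf z →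
      x ≢ y → z ≡ x ⊎ z ≡ y
    core-two {v} {x} {y} {z} cv vx vy vz cx cy cz x≢y with z ≟ x | z ≟ y
    ... | yes e | _     = inj₁ e
    ... | no _  | yes e = inj₂ e
    ... | no z≢x | no z≢y with supported v cv
    ... | l , L = ⊥-elim (no-four x≢y (≢-sym z≢x) (≢l cx) (≢-sym z≢y) (≢l cy) (≢l cz)
      vx vy vz (leaf-adj L))
      where
      ≢l : ∀ {w} → ¬ Leaf w → w ≢ l
      ≢l cw refl = cw (v , L)

    Onward : Fin n → Fin n → Fin n → Set
    Onward u v x = v ~ x × ¬ Leaf x × x ≢ u

    DeadEnd : Fin n → Fin n → Set
    DeadEnd u v = ∀ x → v ~ x → ¬ Leaf x → x ≡ u

    onward? : ∀ u v → Dec (∃ (Onward u v))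
    onward? u v = any? λ x → adj? G v x ×-dec ¬? (leaf? x) ×-dec ¬? (x ≟ u)

    next : Fin n → Fin n → Fin n
    next u v with onward? u v
    ... | yes (x , _) = x
    ... | no _        = v

    next-spec : ∀ u v → Onward u v (next u v) ⊎ (next u v ≡ v × DeadEnd u v)
    next-spec u v with onward? u v
    ... | yes (_ , p) = inj₁ p
    ... | no ¬p = inj₂ (refl , λ x vx cx → decidable-stable (x ≟ u) (λ x≢u → ¬p (x , vx , cx , x≢u)))

    End : Fin n → Set
    End v = ¬ Leaf v × (∀ x y → v ~ x → ¬ Leaf x → v ~ y → ¬ Leaf y → x ≡ y)

    end? : ∀ v → Dec (End v)
    end? v = ¬? (leaf? v) ×-dec all? λ x → all? λ y →
      adj? G v x →-dec ¬? (leaf? x) →-dec adj? G v y →-dec ¬? (leaf? y) →-dec x ≟ y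

    -- w stays put once it cannot go on, so the walk returns to a vertex already visited in any case.
    module Walk (s : Fin n) (core-s : ¬ Leaf s) (end-first : ∀ v → End v → End s) where

      w : ℕ → Fin n
      w zero          = s
      -- The start serves as its own predecessor: it is not its own neighbour, so the first step is
      -- unrestricted.
      w (suc zero)    = next s s
      w (suc (suc t)) = next (w t) (w (suc t))

      prev : ℕ → Fin n
      prev zero    = s
      prev (suc t) = w t

      w-spec : ∀ t → Onward (prev t) (w t) (w (suc t)) ⊎ (w (suc t) ≡ w t × DeadEnd (prev t) (w t))
      w-spec zero    = next-spec s s
      w-spec (suc t) = next-spec (w t) (w (suc t))

      core : ∀ t → ¬ Leaf (w t)
      core zero    = core-s
      core (suc t) with w-spec t
      ... | inj₁ (_ , c , _) = c
      ... | inj₂ (e , _)     = subst (λ v → ¬ Leaf v) (≡-sym e) (core t)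

      Distinct : ℕ → Set
      Distinct k = ∀ i j → i ≤ k → j ≤ k → w i ≡ w j → i ≡ j

      distinct-suc : ∀ {k} → Distinct k → (∀ j → j ≤ k → w (suc k) ≢ w j) → Distinct (suc k)
      distinct-suc d fresh i j i≤ j≤ e with m≤n⇒m<n∨m≡n i≤ | m≤n⇒m<n∨m≡n j≤
      ... | inj₁ i< | inj₁ j<   = d i j (s≤s⁻¹ i<) (s≤s⁻¹ j<) e
      ... | inj₁ i< | inj₂ refl = contradiction (≡-sym e) (fresh i (s≤s⁻¹ i<))
      ... | inj₂ refl | inj₁ j< = contradiction e (fresh j (s≤s⁻¹ j<))
      ... | inj₂ refl | inj₂ e′ = ≡-sym e′

      distinct⇒< : ∀ {k} → Distinct k → k < n
      distinct⇒< {k} d = injective⇒≤ {f = λ (i : Fin (suc k)) → w (toℕ i)}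
        (λ {i} {j} e → toℕ-injective (d (toℕ i) (toℕ j) (s≤s⁻¹ (toℕ<n i)) (s≤s⁻¹ (toℕ<n j)) e))

      Return : ℕ → Set
      Return k = Distinct k × ∃ λ j → j ≤ k × w (suc k) ≡ w j

      return : ∃ Return
      return = go n zero (≤-reflexive (≡-sym (+-identityʳ n))) λ { zero zero _ _ _ → refl }
        where
        go : ∀ fuel k → n ≤ fuel + k → Distinct k → ∃ Return
        -- Without fuel n ≤ k, but k + 1 distinct vertices need k < n.
        go zero       k n≤ d = contradiction (≤-trans (distinct⇒< d) n≤) 1+n≰n
        go (suc fuel) k n≤ d with any? (λ (j : Fin (suc k)) → w (suc k) ≟ w (toℕ j))
        ... | yes (j , e) = k , d , toℕ j , s≤s⁻¹ (toℕ<n j) , e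
        ... | no fresh    = go fuel (suc k) (subst (n ≤_) (≡-sym (+-suc fuel k)) n≤)
          (distinct-suc d λ j j≤ e → fresh (fromℕ< (s≤s j≤) , trans e (cong w (≡-sym (toℕ-fromℕ< (s≤s j≤))))))

      module _ {k} (d : Distinct k) where

        edge : ∀ t → t < k → w t ~ w (suc t)
        edge t t<k with w-spec t
        ... | inj₁ (a , _) = a
        ... | inj₂ (e , _) = contradiction (d (suc t) t t<k (<⇒≤ t<k) e) 1+n≢n

        consecutive-edge : ∀ a b → a ≤ k → b ≤ k → Consecutive a b → w a ~ w b
        consecutive-edge a _ _ b≤ (inj₁ refl) = edge a b≤
        consecutive-edge _ b a≤ _ (inj₂ refl) = ~-sym (edge b a≤)

        -- The predecessor and the successor on the walk are two distinct core neighbours, and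
        -- `core-two` admits no third.
        interior : ∀ t x → suc t < k → w (suc t) ~ x → ¬ Leaf x → x ≡ w t ⊎ x ≡ w (suc (suc t))
        interior t x t<k a cx = core-two (core (suc t)) (~-sym (edge t (<⇒≤ t<k))) (edge (suc t) t<k) a
          (core t) (core (suc (suc t))) cx
          (λ e → <⇒≢ (<-trans (n<1+n t) (n<1+n (suc t)))
            (d t (suc (suc t)) (≤-trans (n≤1+n t) (<⇒≤ t<k)) t<k e))

        -- Positions are bounded naturals here, so the path and cycle cases can split on `zero` and
        -- `suc`; the passage to `Fin` is made once, in `back`.
        enumeration⇒≅ : (F : Graph (suc k)) →
          (∀ i j → Adj F i j → w (toℕ i) ~ w (toℕ j)) →
          (∀ i → i ≤ k → ∀ x → w i ~ x → ¬ Leaf x →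
            ∃ λ j → j ≤ k × w j ≡ x × (∀ (p q : Fin (suc k)) → toℕ p ≡ i → toℕ q ≡ j → Adj F p q)) →
          G ≅ cor F
        enumeration⇒≅ F pres closed = corona⇒≅ F zero (w ∘ toℕ) (core ∘ toℕ)
          (λ {i} {j} e → toℕ-injective (d (toℕ i) (toℕ j) (s≤s⁻¹ (toℕ<n i)) (s≤s⁻¹ (toℕ<n j)) e))
          pres back
          where
          back : ∀ i x → w (toℕ i) ~ x → ¬ Leaf x → ∃ λ j → w (toℕ j) ≡ x × Adj F i j
          back i x a cx with closed (toℕ i) (s≤s⁻¹ (toℕ<n i)) x a cx
          ... | j , j≤ , e , adj = fromℕ< (s≤s j≤) ,
            trans (cong w (toℕ-fromℕ< (s≤s j≤))) e , adj i _ refl (toℕ-fromℕ< (s≤s j≤))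

        path-case : DeadEnd (prev k) (w k) → G ≅ cor (PathG (suc k))
        path-case dead = enumeration⇒≅ (PathG (suc k))
          (λ i j a → consecutive-edge _ _ (s≤s⁻¹ (toℕ<n i)) (s≤s⁻¹ (toℕ<n j)) (path-adj⁻ a))
          λ i i≤ x a cx → pack i (closed i i≤ x a cx)
          where
          pack : ∀ i {x} → (∃ λ j → j ≤ k × w j ≡ x × Consecutive i j) → _
          pack i (j , j≤ , e , c) = j , j≤ , e , λ { p q refl refl → path-adj⁺ c }
          -- The dead end `w k` is an end of the core, so the start is one too; otherwise the walk
          -- might have begun inside the path and missed one side.
          end-s : End s
          end-s = end-first (w k) (core k , λ x y a cx b cy → trans (dead x a cx) (≡-sym (dead y b cy)))
          closed : ∀ i → i ≤ k → ∀ x → w i ~ x → ¬ Leaf x → ∃ λ j → j ≤ k × w j ≡ x × Consecutive i j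
          closed i i≤ x a cx with m≤n⇒m<n∨m≡n i≤
          closed zero    _ x a cx | inj₁ 0<k =
            1 , 0<k , proj₂ end-s (w 1) x (edge 0 0<k) (core 1) a cx , inj₁ refl
          closed (suc t) _ x a cx | inj₁ t<k with interior t x t<k a cx
          ... | inj₁ e = t , <⇒≤ (<⇒≤ t<k) , ≡-sym e , inj₂ refl
          ... | inj₂ e = suc (suc t) , t<k , ≡-sym e , inj₁ refl
          -- Here k = 0 and `prev zero` is `s`, so a core neighbour of `s` would be `s` itself: the
          -- core is a single vertex.
          closed zero    _ x a cx | inj₂ refl = contradiction (≡-sym (dead x a cx)) (~⇒≢ a)
          closed (suc t) _ x a cx | inj₂ refl = t , n≤1+n t , ≡-sym (dead x a cx) , inj₂ refl

        cycle-case : 2 ≤ k → w k ~ s → G ≅ cor (CycleG (suc k))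
        cycle-case 2≤k closing = enumeration⇒≅ (CycleG (suc k))
          (λ i j a → pres (toℕ i) (toℕ j) (s≤s⁻¹ (toℕ<n i)) (s≤s⁻¹ (toℕ<n j)) (cycle-adj⁻ a))
          λ i i≤ x a cx → pack i (closed i i≤ x a cx)
          where
          pres : ∀ a b → a ≤ k → b ≤ k → CycleEdge (suc k) a b → w a ~ w b
          pres a b a≤ b≤ (inj₁ c) = consecutive-edge a b a≤ b≤ c
          pres a b a≤ b≤ (inj₂ (inj₁ (refl , refl))) = closing
          pres a b a≤ b≤ (inj₂ (inj₂ (refl , refl))) = ~-sym closing
          pack : ∀ i {x} → (∃ λ j → j ≤ k × w j ≡ x × CycleEdge (suc k) i j) → _
          pack i (j , j≤ , e , c) = j , j≤ , e , λ { p q refl refl → cycle-adj⁺ (s≤s (<⇒≤ 2≤k)) c }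
          closed : ∀ i → i ≤ k → ∀ x → w i ~ x → ¬ Leaf x → ∃ λ j → j ≤ k × w j ≡ x × CycleEdge (suc k) i j
          closed i i≤ x a cx with m≤n⇒m<n∨m≡n i≤
          closed zero    _ x a cx | inj₁ 0<k with core-two core-s (edge 0 0<k) (~-sym closing) a
            (core 1) (core k) cx (λ e → <⇒≢ 2≤k (d 1 k 0<k ≤-refl e))
          ... | inj₁ e = 1 , 0<k , ≡-sym e , inj₁ (inj₁ refl)
          ... | inj₂ e = k , ≤-refl , ≡-sym e , inj₂ (inj₂ (refl , refl))
          closed (suc t) _ x a cx | inj₁ t<k with interior t x t<k a cx
          ... | inj₁ e = t , <⇒≤ (<⇒≤ t<k) , ≡-sym e , inj₁ (inj₂ refl)
          ... | inj₂ e = suc (suc t) , t<k , ≡-sym e , inj₁ (inj₁ refl)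
          closed zero    _ x a cx | inj₂ refl = contradiction 2≤k λ ()
          closed (suc t) _ x a cx | inj₂ refl with core-two (core k) (~-sym (edge t ≤-refl)) closing a
            (core t) core-s cx (λ e → <⇒≢ (s≤s⁻¹ 2≤k) (≡-sym (d t 0 (n≤1+n t) z≤n e)))
          ... | inj₁ e = t , n≤1+n t , ≡-sym e , inj₁ (inj₂ refl)
          ... | inj₂ e = 0 , z≤n , ≡-sym e , inj₂ (inj₁ (refl , refl))

        -- An interior vertex already has both its core neighbours, so the walk can only return to s.
        only-start : ∀ j → j ≤ k → Onward (prev k) (w k) (w j) → 2 ≤ k × w k ~ s
        only-start j j≤ (a , _ , ≢prev) with m≤n⇒m<n∨m≡n j≤
        ... | inj₂ refl = contradiction refl (~⇒≢ a)
        only-start zero _ (a , _ , ≢prev) | inj₁ 0<k with m≤n⇒m<n∨m≡n 0<k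
        ... | inj₁ 1<k  = 1<k , a
        ... | inj₂ refl = contradiction refl ≢prev
        only-start (suc t) _ (a , _ , ≢prev) | inj₁ t<k with interior t (w k) t<k (~-sym a) (core k)
        ... | inj₁ e = contradiction (≡-sym (d k t ≤-refl (<⇒≤ (<⇒≤ t<k)) e)) (<⇒≢ (<⇒≤ t<k))
        ... | inj₂ e with d k (suc (suc t)) ≤-refl t<k e
        ... | refl = contradiction refl ≢prev

      -- At the first repetition the walk either stayed put, which means a dead end and a path, or
      -- moved on to an earlier vertex, which must be `s` and closes a cycle.
      walk⇒extremal : Extremal G
      walk⇒extremal with return
      ... | k , d , j , j≤ , e with w-spec k
      ... | inj₂ (_ , dead) = inj₂ (inj₁ (suc k , s≤s z≤n , ≅cor⇒≡2* G (PathG (suc k)) iso , iso))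
        where iso = path-case d dead
      ... | inj₁ on with only-start d j j≤ (subst (Onward (prev k) (w k)) e on)
      ... | 2≤k , closing = inj₂ (inj₂ (suc k , s≤s 2≤k , ≅cor⇒≡2* G (CycleG (suc k)) iso , iso))
        where iso = cycle-case d 2≤k closing

    -- Starting at an end whenever there is one secures `end-first`; if there is none, `end-first`
    -- is vacuous and any core vertex will do.
    corona-extremal : ∀ v → ¬ Leaf v → Extremal G
    corona-extremal v cv with any? end?
    ... | yes (s , end) = Walk.walk⇒extremal s (proj₁ end) (λ _ _ → end)
    ... | no none       = Walk.walk⇒extremal v cv (λ u end → contradiction (u , end) none)

  two? : ∀ v → Dec (∃₂ λ a b → Nbrs G v (a ∷ b ∷ []))
  two? v with view v (no-isolated v)
  ... | two a b N = yes (a , b , N)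
  ... | one a N   = no λ { (_ , _ , N′) → no-leaf-two N′ (a , N) }
  ... | three _ _ _ (nbrs q s _) = no λ { (_ , _ , N′) →
    1+n≰n (≤-trans (length≤deg q s) (Nbrs⇒deg≤ N′)) }

  N-edge : Fin 2 → List (Fin 2)
  N-edge 0F = 1F ∷ []
  N-edge 1F = 0F ∷ []

  critical⇒extremal : Fin n → Extremal G
  critical⇒extremal v₀ with any? leaf?
  critical⇒extremal v₀ | no none with any? two?
  ... | yes (v , a , b , N) = inj₁ (inj₁ (Leafless.square (λ v L → none (v , L)) N))
  ... | no ¬two = inj₁ (inj₂ (inj₁ (Leafless.cubic (λ v L → none (v , L))
    (λ N → ¬two (_ , _ , _ , N)) v₀)))
  critical⇒extremal v₀ | yes (l , u , Ll)
    with any? (λ u → any? λ x → any? λ y → leafOf? u x ×-dec leafOf? u y ×-dec ¬? (x ≟ y))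
  ... | yes (_ , _ , _ , Lx , Ly , x≢y) =
    inj₁ (inj₂ (inj₂ (inj₂ (inj₁ (double-star x≢y Lx Ly)))))
  ... | no ¬double = by-support (any? λ v → ¬? (leaf? v) ×-dec ¬? (support? v))
    where
    single : ∀ {u x y} → LeafOf u x → LeafOf u y → x ≡ y
    single {u} {x} {y} Lx Ly = decidable-stable (x ≟ y) (λ x≢y → ¬double (u , x , y , Lx , Ly , x≢y))

    -- On a walk to the leaf `l`, some unsupported non-leaf is followed by a support; this is the
    -- configuration of `Exceptional`. A leaf cannot come next, as its only neighbour would be its
    -- support.
    exceptional : ∀ {v} → Reach G v l → ¬ Leaf v → ¬ Support v → G ≅ G3 ⊎ G ≅ G5
    exceptional here ¬leaf _ = contradiction (u , Ll) ¬leaf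
    exceptional (step {v = x} vx r) ¬leaf ¬support with leaf? x
    ... | yes (y , Lx) = contradiction
      (x , subst (λ y → LeafOf y x) (≡-sym (leaf-nbr Lx (~-sym vx))) Lx) ¬support
    ... | no ¬leaf-x with support? x
    ... | no ¬support-x = exceptional r ¬leaf-x ¬support-x
    ... | yes (_ , L)   = SingleLeaves.Exceptional.exceptional single L (~-sym vx) ¬leaf ¬support

    by-core : (∀ v → ¬ Leaf v → Support v) → Dec (∃ λ v → ¬ Leaf v) → Extremal G
    by-core supported (yes (v , cv)) = Corona.corona-extremal single supported v cv
    -- If all vertices are leaves, `l` and `u` are leaves of each other: K₂, the corona of a single
    -- vertex.
    by-core _ (no all-leaves) = inj₂ (inj₁ (1 , ≤-refl , ≅cor⇒≡2* G (PathG 1) iso , iso))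
      where
      Lu : LeafOf l u
      Lu with decidable-stable (leaf? u) (λ ¬L → all-leaves (u , ¬L))
      ... | y , Lu = subst (λ y → LeafOf y u) (≡-sym (leaf-nbr Lu (leaf-adj Ll))) Lu
      iso : G ≅ cor (PathG 1)
      iso = labelling⇒≅ G connected l (u ∷ []) (cor (PathG 1)) N-edge
        ((~⇒≢ (~-sym (leaf-adj Ll)) ∷ []) ∷ [] ∷ []) λ { 0F → Ll ; 1F → Lu }

    by-support : Dec (∃ λ v → ¬ Leaf v × ¬ Support v) → Extremal G
    by-support (yes (v , ¬leaf , ¬support)) with exceptional (connected v l) ¬leaf ¬support
    ... | inj₁ iso = inj₁ (inj₂ (inj₂ (inj₁ iso)))
    ... | inj₂ iso = inj₁ (inj₂ (inj₂ (inj₂ (inj₂ iso))))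
    by-support (no none) = by-core
      (λ v ¬leaf → decidable-stable (support? v) (λ ¬support → none (v , ¬leaf , ¬support)))
      (any? λ v → ¬? (leaf? v))

-- Extremality

∣∣≡count : ∀ {n} (S : Subset n) → ∣ S ∣ ≡ count (Vec.lookup S)
∣∣≡count Vec.[]          = refl
∣∣≡count (true Vec.∷ S) = cong suc (∣∣≡count S)
∣∣≡count (false Vec.∷ S) = ∣∣≡count S

∣tabulate∣ : ∀ {n} (p : Fin n → Bool) → ∣ Vec.tabulate p ∣ ≡ count p
∣tabulate∣ {n} p = trans (∣∣≡count (Vec.tabulate p)) (sum-cong-≗ {n} (λ x → cong ind (lookup∘tabulate p x)))

∈-tabulate⁻ : ∀ {n} (p : Fin n → Bool) {x} → x ∈ Vec.tabulate p → p x ≡ true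
∈-tabulate⁻ p {x} x∈ = trans (≡-sym (lookup∘tabulate p x)) ([]=⇒lookup x∈)

∈-tabulate⁺ : ∀ {n} (p : Fin n → Bool) {x} → p x ≡ true → x ∈ Vec.tabulate p
∈-tabulate⁺ p {x} px = lookup⇒[]= x (Vec.tabulate p) (trans (lookup∘tabulate p x) px)

¬true⇒false : ∀ {b} → b ≢ true → b ≡ false
¬true⇒false {true}  h = contradiction refl h
¬true⇒false {false} h = refl

Σᶠ-1 : ∀ n → Σᶠ {n} (λ _ → 1) ≡ n
Σᶠ-1 zero    = refl
Σᶠ-1 (suc n) = cong suc (Σᶠ-1 n)

activeCount≤ : ∀ {n} (G : Graph n) → activeCount G ≤ n
activeCount≤ {n} G = ≤-trans (Σᶠ-mono {n} {g = λ _ → 1} (λ _ → ind-mono {b = true} (λ _ → refl))) (≤-reflexive (Σᶠ-1 n))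

selection⇒IndepDom : ∀ {n} {G : Graph n} → NoIsolated G → (T : Selection G) →
  IndepDom G (Vec.tabulate (chosen T))
selection⇒IndepDom {G = G} no-isolated T =
  (λ u v u∈ v∈ → ¬true⇒false (indep T u v (∈-tabulate⁻ (chosen T) u∈) (∈-tabulate⁻ (chosen T) v∈))) ,
  dominates
  where
  dominates : Dominating G (Vec.tabulate (chosen T))
  dominates u u∉ with dom T u (no-isolated u) (λ e → u∉ (∈-tabulate⁺ (chosen T) e))
  ... | v , e , uv = v , ∈-tabulate⁺ (chosen T) e , uv

half-IndepDom : ∀ {n} (G : Graph n) → Subcubic G → NoIsolated G →
  ∃ λ (S : Subset n) → IndepDom G S × 2 * ∣ S ∣ ≤ n
half-IndepDom {n} G sub no-isolated with half-selection G sub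
... | T , T≤ = _ , selection⇒IndepDom no-isolated T ,
  subst (λ c → 2 * c ≤ n) (≡-sym (∣tabulate∣ (chosen T))) (≤-trans T≤ (activeCount≤ G))

-- In `extend-bound` the degree now exceeds 1 + k, which makes the inequality strict.
uncritical⇒small : ∀ {n} (G : Graph n) → Subcubic G → NoIsolated G →
  ∀ v → 1 + captives G v < deg G v → ∃ λ (S : Subset n) → IndepDom G S × 2 * ∣ S ∣ < n
uncritical⇒small {n} G sub no-isolated v k<d = _ , selection⇒IndepDom no-isolated extend ,
  subst (λ c → 2 * c < n) (≡-sym (∣tabulate∣ (chosen extend)))
    (≤-trans (+-cancelʳ-≤ (1 + captives G v) _ _
      (≤-trans (≤-reflexive (≡-sym (+-suc _ (1 + captives G v))))
        (≤-trans (+-monoʳ-≤ _ k<d) (extend-bound (proj₂ rest))))) (activeCount≤ G))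
  where
  rest = half-selection (isolate G v) (isolate-subcubic {G = G} sub)
  open Isolate.Extend G v (no-isolated v) (proj₁ rest)

-- Lower bounds for the listed graphs.

LowerBound : ∀ {n} → Graph n → Set
LowerBound {n} G = ∀ S → IndepDom G S → n ≤ 2 * ∣ S ∣

lowerBound-≅ : ∀ {n m} {G : Graph n} {H : Graph m} → G ≅ H → LowerBound H → LowerBound G
lowerBound-≅ {n} {m} {G} {H} (f , f-adj) bound S (ind-S , dom-S) =
  subst₂ (λ a b → a ≤ 2 * b) (≡-sym (↔⇒≡ f)) size (bound S′ (independent , dominating))
  where
  open Inverse f using (to; from)
  p : Fin m → Bool
  p j = Vec.lookup S (from j)
  S′ = Vec.tabulate p
  size : ∣ S′ ∣ ≡ ∣ S ∣
  size = trans (∣tabulate∣ p) (trans (sum-permute (ind ∘ p) f)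
    (trans (sum-cong-≗ {n} (λ i → cong (ind ∘ Vec.lookup S) (inverseˡ f))) (≡-sym (∣∣≡count S))))
  back : ∀ {j} → j ∈ S′ → from j ∈ S
  back {j} j∈ = lookup⇒[]= (from j) S (∈-tabulate⁻ p j∈)
  adj-from : ∀ i j → adj G (from i) (from j) ≡ adj H i j
  adj-from i j = trans (f-adj (from i) (from j)) (cong₂ (adj H) (inverseʳ f) (inverseʳ f))
  independent : Independent H S′
  independent i j i∈ j∈ = trans (≡-sym (adj-from i j)) (ind-S _ _ (back i∈) (back j∈))
  dominating : Dominating H S′
  dominating j j∉ with dom-S (from j) (λ j∈ → j∉ (∈-tabulate⁺ p ([]=⇒lookup j∈)))
  ... | v , v∈ , a = to v , ∈-tabulate⁺ p (trans (cong (Vec.lookup S) (inverseˡ f)) ([]=⇒lookup v∈)) ,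
    trans (≡-sym (adj-from j (to v))) (trans (cong (adj G (from j)) (inverseˡ f)) a)

-- A search for a counterexample, the existential form that `anySubset?` decides.
-- `decided-lowerBound` has the failure of this search evaluated for `G1` to `G5`.
lowerBound-fails? : ∀ {n} (G : Graph n) → Dec (∃ λ S → IndepDom G S × ¬ n ≤ 2 * ∣ S ∣)
lowerBound-fails? {n} G = anySubset? λ S →
  ((all? λ u → all? λ v → u ∈? S →-dec v ∈? S →-dec adj G u v Bool.≟ false)
    ×-dec (all? λ u → ¬? (u ∈? S) →-dec any? λ v → v ∈? S ×-dec adj? G u v))
  ×-dec ¬? (n ≤? 2 * ∣ S ∣)

decided-lowerBound : ∀ {n} (G : Graph n) → {False (lowerBound-fails? G)} → LowerBound G
decided-lowerBound {n} G {ok} S id = decidable-stable (n ≤? 2 * ∣ S ∣)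
  (λ n≰ → toWitnessFalse ok (S , id , n≰))

Σᶠ-++ : ∀ k {m} (f : Fin (k + m) → ℕ) → Σᶠ f ≡ Σᶠ (λ i → f (i ↑ˡ m)) + Σᶠ (λ j → f (k ↑ʳ j))
Σᶠ-++ zero    f = refl
Σᶠ-++ (suc k) f = trans (cong (f zero +_) (Σᶠ-++ k (f ∘ suc))) (≡-sym (+-assoc (f zero) _ _))

-- S meets each of the k disjoint edges joining i to its leaf.
cor-lowerBound : ∀ {k} (F : Graph k) → LowerBound (cor F)
cor-lowerBound {k} F S (_ , dom) = subst (k + k ≤_) (cong (∣ S ∣ +_) (≡-sym (+-identityʳ ∣ S ∣)))
  (+-mono-≤ k≤ k≤)
  where
  met : ∀ i → 1 ≤ ind (Vec.lookup S (i ↑ˡ k)) + ind (Vec.lookup S (k ↑ʳ i))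
  met i with (k ↑ʳ i) ∈? S
  ... | yes l∈ = subst (λ b → 1 ≤ ind (Vec.lookup S (i ↑ˡ k)) + ind b) (≡-sym ([]=⇒lookup l∈)) (m≤n+m 1 _)
  ... | no  l∉ with dom (k ↑ʳ i) l∉
  ... | v , v∈ , a with splitAt k (k ↑ʳ i) | splitAt-↑ʳ k k i | splitAt k v in eq | cor-adj⁻ F (k ↑ʳ i) v a
  ... | _ | refl | inj₁ _ | refl with refl ← splitAt⁻¹-↑ˡ {k} {k} {v} eq =
    subst (λ b → 1 ≤ ind b + ind (Vec.lookup S (k ↑ʳ i))) (≡-sym ([]=⇒lookup v∈)) (s≤s z≤n)
  k≤ : k ≤ ∣ S ∣
  k≤ = begin
    k ≡⟨ ≡-sym (Σᶠ-1 k) ⟩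
    Σᶠ {k} (λ _ → 1) ≤⟨ Σᶠ-mono met ⟩
    Σᶠ (λ i → ind (Vec.lookup S (i ↑ˡ k)) + ind (Vec.lookup S (k ↑ʳ i))) ≡⟨ ∑-distrib-+ {k} _ _ ⟩
    Σᶠ (λ i → ind (Vec.lookup S (i ↑ˡ k))) + Σᶠ (λ i → ind (Vec.lookup S (k ↑ʳ i)))
      ≡⟨ ≡-sym (Σᶠ-++ k (λ x → ind (Vec.lookup S x))) ⟩
    count (Vec.lookup S) ≡⟨ ≡-sym (∣∣≡count S) ⟩
    ∣ S ∣ ∎
    where open ≤-Reasoning

extremal⇒lowerBound : ∀ {n} {G : Graph n} → Extremal G → LowerBound G
extremal⇒lowerBound {G = G} (inj₁ (inj₁ iso)) = lowerBound-≅ {G = G} {G1} iso (decided-lowerBound G1)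
extremal⇒lowerBound {G = G} (inj₁ (inj₂ (inj₁ iso))) = lowerBound-≅ {G = G} {G2} iso (decided-lowerBound G2)
extremal⇒lowerBound {G = G} (inj₁ (inj₂ (inj₂ (inj₁ iso)))) = lowerBound-≅ {G = G} {G3} iso (decided-lowerBound G3)
extremal⇒lowerBound {G = G} (inj₁ (inj₂ (inj₂ (inj₂ (inj₁ iso))))) = lowerBound-≅ {G = G} {G4} iso (decided-lowerBound G4)
extremal⇒lowerBound {G = G} (inj₁ (inj₂ (inj₂ (inj₂ (inj₂ iso))))) = lowerBound-≅ {G = G} {G5} iso (decided-lowerBound G5)
extremal⇒lowerBound {G = G} (inj₂ (inj₁ (k , _ , _ , iso))) =
  lowerBound-≅ {G = G} {cor (PathG k)} iso (cor-lowerBound (PathG k))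
extremal⇒lowerBound {G = G} (inj₂ (inj₂ (k , _ , _ , iso))) =
  lowerBound-≅ {G = G} {cor (CycleG k)} iso (cor-lowerBound (CycleG k))

theorem5 : ∀ {n : ℕ} (G : Graph n) → Subcubic G → NoIsolated G →
    (∃ λ (S : Subset n) → IndepDom G S × 2 * ∣ S ∣ ≤ n)
    × (1 ≤ n → Connected G → ∀ (i : ℕ) → IsIndepDomNumber G i →
    (2 * i ≡ n ⇔
    ((G ≅ G1 ⊎ G ≅ G2 ⊎ G ≅ G3 ⊎ G ≅ G4 ⊎ G ≅ G5)
    ⊎ (Σ ℕ λ k → 1 ≤ k × n ≡ 2 * k × G ≅ cor (PathG k))
    ⊎ (Σ ℕ λ k → 3 ≤ k × n ≡ 2 * k × G ≅ cor (CycleG k)))))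
theorem5 {n} G sub no-isolated = half , λ 1≤n connected i (attained , minimal) →
  mk⇔ (forward 1≤n connected i minimal) (backward i attained minimal)
  where
  half = half-IndepDom G sub no-isolated

  forward : 1 ≤ n → Connected G → ∀ i → (∀ S → IndepDom G S → i ≤ ∣ S ∣) → 2 * i ≡ n → Extremal G
  forward (s≤s _) connected i minimal eq =
    CriticalStructure.critical⇒extremal G sub no-isolated connected critical zero
    where
    critical : ∀ v → deg G v ≤ 1 + captives G v
    -- An uncritical `v` would give 2|S| < n = 2i ≤ 2|S|.
    critical v = ≮⇒≥ λ k<d → let S , id , small = uncritical⇒small G sub no-isolated v k<d in
      <-irrefl refl (<-≤-trans small (subst (_≤ 2 * ∣ S ∣) eq (*-monoʳ-≤ 2 (minimal S id))))

  backward : ∀ i → (∃ λ S → IndepDom G S × ∣ S ∣ ≡ i) → (∀ S → IndepDom G S → i ≤ ∣ S ∣) →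
    Extremal G → 2 * i ≡ n
  -- Minimality against the half-size set gives 2i ≤ n; the lower bound applied to the set attaining
  -- i gives n ≤ 2i.
  backward i (S , id , refl) minimal ext = ≤-antisym
    (≤-trans (*-monoʳ-≤ 2 (minimal (proj₁ half) (proj₁ (proj₂ half)))) (proj₂ (proj₂ half)))
    (extremal⇒lowerBound {G = G} ext S id)
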